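{- Let $W$ be an irreducible $T$-module. Then the triple $A, A^*, A^{\varepsilon}$ acts on $W$ as a Leonard triple; that is, the restrictions of $A$, $A^*$, $A^{\varepsilon}$ to $W$ form a Leonard triple on $W$.
   Context: Let $D$ be a positive integer and let $Q_D$ be the $D$-cube: the graph with vertex set $X=\{0,1\}^D$, two vertices being adjacent iff they differ in exactly one coordinate; $\partial$ denotes path-length distance. $\mathrm{Mat}_X(\mathbb{C})$ is the algebra of complex matrices with rows and columns indexed by $X$, acting on $V=\mathbb{C}^X$ (column vectors) by left multiplication. Write $\mathbf{i}^2=-1$. Let $A$ be the adjacency matrix of $Q_D$. Fix $x=(0,0,\ldots,0)\in X$. Let $A^*$ be the diagonal matrix in $\mathrm{Mat}_X(\mathbb{C})$ with $(y,y)$-entry $D-2\partial(x,y)$ for $y\in X$ (the dual adjacency matrix). Let $A^{\varepsilon}=-\mathbf{i}(AA^*-A^*A)/2$ (the imaginary adjacency matrix). Let $T$ be the subalgebra of $\mathrm{Mat}_X(\mathbb{C})$ generated by $A$ and $A^*$ (the Terwilliger algebra). A $T$-module is a subspace $W\subseteq V$ with $BW\subseteq W$ for all $B\in T$; it is irreducible if $W\neq 0$ and $W$ contains no $T$-modules other than $0$ and $W$. A square complex matrix is tridiagonal if each nonzero entry lies on the diagonal, the subdiagonal or the superdiagonal; a tridiagonal matrix is irreducible if every entry on the subdiagonal and every entry on the superdiagonal is nonzero. For a complex vector space $U$ of finite positive dimension, a Leonard triple on $U$ is an ordered triple of linear operators $(L_1,L_2,L_3)$ on $U$ such that for each $k\in\{1,2,3\}$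 there is a basis of $U$ with respect to which the matrix representing $L_k$ is diagonal and the matrices representing the other two operators are irreducible tridiagonal. -}

module Defs where

open import Algebra.Bundles using (CommutativeRing)
open import Algebra.Module.Bundles using (LeftModule)
import Algebra.Module.Morphism.Structures as ModuleMorphism
open import Algebra.Structures using (IsAbelianGroup)
import Algebra.Definitions.RawMonoid as RawMonoidSum
import Algebra.Properties.Ring as RingProperties
import Algebra.Properties.CommutativeSemigroup as CommutativeSemigroupProperties
open import Data.Bool.Base using (Bool; true; false; _xor_; if_then_else_)
import Data.Bool.Properties as Bool
open import Data.Fin.Base using (Fin; zero; suc; toℕ)
open import Data.Fin.Subset using (∣_∣)
open import Data.Nat.Base as ℕ using (ℕ; zero; suc)
import Data.Nat.Properties as ℕ
open import Data.Product.Base using (Σ; ∃; ∃-syntax; _×_; _,_; proj₁; proj₂)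
open import Data.Rational.Base as ℚ using (ℚ; 0ℚ; 1ℚ; ½)
import Data.Rational.Properties as ℚ
open import Data.Rational.Solver using (module +-*-Solver)
open import Data.Sum.Base using (_⊎_)
open import Data.Vec.Base using (Vec; []; _∷_; replicate; zipWith)
import Data.Vec.Functional as Vector
import Data.Vec.Properties as Vec
open import Level using (0ℓ)
open import Relation.Binary.PropositionalEquality as ≡ using (_≡_; _≢_; refl; cong; subst)
open import Relation.Nullary using (¬_; does)
open import Relation.Unary using (Pred; _∈_; _⊆_)

-- ℝ is the setoid of Cauchy sequences of rationals modulo null sequences,
-- with termwise operations.

Null : (ℕ → ℚ) → Set
Null z = ∀ ε → 0ℚ ℚ.< ε → ∃[ N ] (∀ n → N ℕ.≤ n → ℚ.∣ z n ∣ ℚ.< ε)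

Cauchy : (ℕ → ℚ) → Set
Cauchy x = ∀ ε → 0ℚ ℚ.< ε →
  ∃[ N ] (∀ m n → N ℕ.≤ m → N ℕ.≤ n → ℚ.∣ x m ℚ.- x n ∣ ℚ.< ε)

record ℝ : Set where
  no-eta-equality
  field
    seq    : ℕ → ℚ
    cauchy : Cauchy seq

open ℝ public

infix 4 _≈ʳ_
record _≈ʳ_ (x y : ℝ) : Set where
  constructor null-difference
  field
    null : Null (λ n → seq x n ℚ.- seq y n)

open _≈ʳ_ public

module ℚ-identities where
  open +-*-Solver

  b+[a-b] : ∀ a b → b ℚ.+ (a ℚ.- b) ≡ a
  b+[a-b] = solve 2 (λ a b → b :+ (a :- b) := a) refl

  interchange : ∀ a b c d → (a ℚ.- b) ℚ.+ (c ℚ.- d) ≡ (a ℚ.+ c) ℚ.- (b ℚ.+ d)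
  interchange = solve 4 (λ a b c d → (a :- b) :+ (c :- d) := (a :+ c) :- (b :+ d)) refl

  neg-diff : ∀ a b → ℚ.- (a ℚ.- b) ≡ b ℚ.- a
  neg-diff = solve 2 (λ a b → :- (a :- b) := b :- a) refl

  diff-neg : ∀ a b → b ℚ.- a ≡ (ℚ.- a) ℚ.- (ℚ.- b)
  diff-neg = solve 2 (λ a b → b :- a := (:- a) :- (:- b)) refl

  telescope : ∀ a b c → (a ℚ.- b) ℚ.+ (b ℚ.- c) ≡ a ℚ.- c
  telescope = solve 3 (λ a b c → (a :- b) :+ (b :- c) := a :- c) refl

  product-diff : ∀ a b c d →
    a ℚ.* (c ℚ.- d) ℚ.+ d ℚ.* (a ℚ.- b) ≡ a ℚ.* c ℚ.- b ℚ.* d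
  product-diff = solve 4 (λ a b c d → a :* (c :- d) :+ d :* (a :- b) := a :* c :- b :* d) refl

  identity-re : ∀ a b → 1ℚ ℚ.* a ℚ.+ ℚ.- (0ℚ ℚ.* b) ≡ a
  identity-re = solve 2 (λ a b → con 1ℚ :* a :+ (:- (con 0ℚ :* b)) := a) refl

  identity-im : ∀ a b → 1ℚ ℚ.* b ℚ.+ 0ℚ ℚ.* a ≡ b
  identity-im = solve 2 (λ a b → con 1ℚ :* b :+ con 0ℚ :* a := b) refl

  assoc-re : ∀ a b c d e f →
    (a ℚ.* c ℚ.+ ℚ.- (b ℚ.* d)) ℚ.* e ℚ.+ ℚ.- ((a ℚ.* d ℚ.+ b ℚ.* c) ℚ.* f) ≡
    a ℚ.* (c ℚ.* e ℚ.+ ℚ.- (d ℚ.* f)) ℚ.+ ℚ.- (b ℚ.* (c ℚ.* f ℚ.+ d ℚ.* e))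
  assoc-re = solve 6 (λ a b c d e f →
    (a :* c :+ (:- (b :* d))) :* e :+ (:- ((a :* d :+ b :* c) :* f)) :=
    a :* (c :* e :+ (:- (d :* f))) :+ (:- (b :* (c :* f :+ d :* e)))) refl

  assoc-im : ∀ a b c d e f →
    (a ℚ.* c ℚ.+ ℚ.- (b ℚ.* d)) ℚ.* f ℚ.+ (a ℚ.* d ℚ.+ b ℚ.* c) ℚ.* e ≡
    a ℚ.* (c ℚ.* f ℚ.+ d ℚ.* e) ℚ.+ b ℚ.* (c ℚ.* e ℚ.+ ℚ.- (d ℚ.* f))
  assoc-im = solve 6 (λ a b c d e f →
    (a :* c :+ (:- (b :* d))) :* f :+ (a :* d :+ b :* c) :* e :=
    a :* (c :* f :+ d :* e) :+ b :* (c :* e :+ (:- (d :* f)))) refl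

  distrib-re : ∀ a b c d e f →
    a ℚ.* (c ℚ.+ e) ℚ.+ ℚ.- (b ℚ.* (d ℚ.+ f)) ≡
    (a ℚ.* c ℚ.+ ℚ.- (b ℚ.* d)) ℚ.+ (a ℚ.* e ℚ.+ ℚ.- (b ℚ.* f))
  distrib-re = solve 6 (λ a b c d e f →
    a :* (c :+ e) :+ (:- (b :* (d :+ f))) :=
    (a :* c :+ (:- (b :* d))) :+ (a :* e :+ (:- (b :* f)))) refl

  distrib-im : ∀ a b c d e f →
    a ℚ.* (d ℚ.+ f) ℚ.+ b ℚ.* (c ℚ.+ e) ≡
    (a ℚ.* d ℚ.+ b ℚ.* c) ℚ.+ (a ℚ.* f ℚ.+ b ℚ.* e)
  distrib-im = solve 6 (λ a b c d e f →
    a :* (d :+ f) :+ b :* (c :+ e) :=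
    (a :* d :+ b :* c) :+ (a :* f :+ b :* e)) refl

module ℚI = ℚ-identities

half : ∀ ε → 0ℚ ℚ.< ε → ∃[ δ ] (0ℚ ℚ.< δ × δ ℚ.+ δ ≡ ε)
half ε ε>0 = ½ ℚ.* ε
  , subst (ℚ._< ½ ℚ.* ε) (ℚ.*-zeroʳ ½) (ℚ.*-monoʳ-<-pos ½ ε>0)
  , ≡.trans (≡.sym (ℚ.*-distribʳ-+ ε ½ ½)) (ℚ.*-identityˡ ε)

divide : ∀ B → 0ℚ ℚ.< B → ∀ ε → 0ℚ ℚ.< ε → ∃[ δ ] (0ℚ ℚ.< δ × B ℚ.* δ ≡ ε)
divide B B>0 ε ε>0 = B⁻¹ ℚ.* ε
  , subst (ℚ._< B⁻¹ ℚ.* ε) (ℚ.*-zeroʳ B⁻¹) (ℚ.*-monoʳ-<-pos B⁻¹ {{B⁻¹>0}} ε>0)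
  , ≡.trans (≡.sym (ℚ.*-assoc B B⁻¹ ε))
      (≡.trans (cong (ℚ._* ε) (ℚ.*-inverseʳ B {{B≢0}})) (ℚ.*-identityˡ ε))
  where
  B≢0  = ℚ.pos⇒nonZero B {{ℚ.positive B>0}}
  B⁻¹  = (ℚ.1/ B) {{B≢0}}
  B⁻¹>0 = ℚ.1/pos⇒pos B {{ℚ.positive B>0}}

sum-small : ∀ {a b δ ε} → δ ℚ.+ δ ≡ ε →
            ℚ.∣ a ∣ ℚ.< δ → ℚ.∣ b ∣ ℚ.< δ → ℚ.∣ a ℚ.+ b ∣ ℚ.< ε
sum-small {a} {b} refl a<δ b<δ =
  ℚ.≤-<-trans (ℚ.∣p+q∣≤∣p∣+∣q∣ a b) (ℚ.+-mono-< a<δ b<δ)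

product-small : ∀ {a b B δ ε} → 0ℚ ℚ.< B → B ℚ.* δ ≡ ε →
                ℚ.∣ a ∣ ℚ.< B → ℚ.∣ b ∣ ℚ.< δ → ℚ.∣ a ℚ.* b ∣ ℚ.< ε
product-small {a} {b} {B} B>0 refl a<B b<δ = subst (ℚ._< _) (≡.sym (ℚ.∣p*q∣≡∣p∣*∣q∣ a b))
  (ℚ.≤-<-trans (ℚ.*-monoʳ-≤-nonNeg ℚ.∣ b ∣ {{ℚ.∣-∣-nonNeg b}} (ℚ.<⇒≤ a<B))
               (ℚ.*-monoʳ-<-pos B {{ℚ.positive B>0}} b<δ))

EventuallyBounded : (ℕ → ℚ) → Set
EventuallyBounded x = ∃[ B ] (0ℚ ℚ.< B × ∃[ N ] (∀ n → N ℕ.≤ n → ℚ.∣ x n ∣ ℚ.< B))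

1>0 : 0ℚ ℚ.< 1ℚ
1>0 = ℚ.positive⁻¹ 1ℚ

cauchy⇒bounded : ∀ {x} → Cauchy x → EventuallyBounded x
cauchy⇒bounded {x} cx with cx 1ℚ 1>0
... | N , close = B , ℚ.≤-<-trans (ℚ.0≤∣p∣ (x N)) xN<B , N , λ n N≤n →
      ℚ.≤-<-trans
        (subst (λ p → ℚ.∣ p ∣ ℚ.≤ ℚ.∣ x N ∣ ℚ.+ ℚ.∣ x n ℚ.- x N ∣)
          (ℚI.b+[a-b] (x n) (x N))
          (ℚ.∣p+q∣≤∣p∣+∣q∣ (x N) (x n ℚ.- x N)))
        (ℚ.+-monoʳ-< ℚ.∣ x N ∣ (close n N N≤n ℕ.≤-refl))
  where
  B = ℚ.∣ x N ∣ ℚ.+ 1ℚ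
  xN<B : ℚ.∣ x N ∣ ℚ.< B
  xN<B = subst (ℚ._< B) (ℚ.+-identityʳ ℚ.∣ x N ∣) (ℚ.+-monoʳ-< ℚ.∣ x N ∣ 1>0)

null-≗ : ∀ {y z} → (∀ n → y n ≡ z n) → Null y → Null z
null-≗ y≗z ny ε ε>0 with ny ε ε>0
... | N , small = N , λ n N≤n → subst (λ p → ℚ.∣ p ∣ ℚ.< ε) (y≗z n) (small n N≤n)

null-0 : Null (λ _ → 0ℚ)
null-0 ε ε>0 = 0 , λ _ _ → ε>0

null-+ : ∀ {y z} → Null y → Null z → Null (λ n → y n ℚ.+ z n)
null-+ {y} {z} ny nz ε ε>0 with half ε ε>0
... | δ , δ>0 , δ+δ≡ε with ny δ δ>0 | nz δ δ>0
... | M , small₁ | N , small₂ = M ℕ.⊔ N , λ n M⊔N≤n →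
      sum-small {y n} {z n} δ+δ≡ε
        (small₁ n (ℕ.≤-trans (ℕ.m≤m⊔n M N) M⊔N≤n))
        (small₂ n (ℕ.≤-trans (ℕ.m≤n⊔m M N) M⊔N≤n))

null-neg : ∀ {z} → Null z → Null (λ n → ℚ.- z n)
null-neg {z} nz ε ε>0 with nz ε ε>0
... | N , small = N , λ n N≤n → subst (ℚ._< ε) (≡.sym (ℚ.∣-p∣≡∣p∣ (z n))) (small n N≤n)

null-* : ∀ {x z} → EventuallyBounded x → Null z → Null (λ n → x n ℚ.* z n)
null-* {x} {z} (B , B>0 , M , bounded) nz ε ε>0 with divide B B>0 ε ε>0
... | δ , δ>0 , Bδ≡ε with nz δ δ>0
... | N , small = M ℕ.⊔ N , λ n M⊔N≤n →
      product-small {x n} {z n} B>0 Bδ≡ε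
        (bounded n (ℕ.≤-trans (ℕ.m≤m⊔n M N) M⊔N≤n))
        (small n (ℕ.≤-trans (ℕ.m≤n⊔m M N) M⊔N≤n))

cauchy-+ : ∀ {x y} → Cauchy x → Cauchy y → Cauchy (λ n → x n ℚ.+ y n)
cauchy-+ {x} {y} cx cy ε ε>0 with half ε ε>0
... | δ , δ>0 , δ+δ≡ε with cx δ δ>0 | cy δ δ>0
... | M , close₁ | N , close₂ = M ℕ.⊔ N , λ m n p q →
      subst (λ r → ℚ.∣ r ∣ ℚ.< ε)
        (ℚI.interchange (x m) (x n) (y m) (y n))
        (sum-small {x m ℚ.- x n} {y m ℚ.- y n} δ+δ≡ε
          (close₁ m n (ℕ.≤-trans (ℕ.m≤m⊔n M N) p) (ℕ.≤-trans (ℕ.m≤m⊔n M N) q))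
          (close₂ m n (ℕ.≤-trans (ℕ.m≤n⊔m M N) p) (ℕ.≤-trans (ℕ.m≤n⊔m M N) q)))

cauchy-neg : ∀ {x} → Cauchy x → Cauchy (λ n → ℚ.- x n)
cauchy-neg {x} cx ε ε>0 with cx ε ε>0
... | N , close = N , λ m n p q →
      subst (λ r → ℚ.∣ r ∣ ℚ.< ε)
        (ℚI.diff-neg (x m) (x n))
        (close n m q p)

product-close : ∀ {a b c d B C β γ δ ε} → 0ℚ ℚ.< B → 0ℚ ℚ.< C →
                B ℚ.* β ≡ δ → C ℚ.* γ ≡ δ → δ ℚ.+ δ ≡ ε →
                ℚ.∣ a ∣ ℚ.< B → ℚ.∣ d ∣ ℚ.< C →
                ℚ.∣ c ℚ.- d ∣ ℚ.< β → ℚ.∣ a ℚ.- b ∣ ℚ.< γ →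
                ℚ.∣ a ℚ.* c ℚ.- b ℚ.* d ∣ ℚ.< ε
product-close {a} {b} {c} {d} {ε = ε} B>0 C>0 Bβ≡δ Cγ≡δ δ+δ≡ε a<B d<C c-d<β a-b<γ =
  subst (λ r → ℚ.∣ r ∣ ℚ.< ε) (ℚI.product-diff a b c d)
    (sum-small {a ℚ.* (c ℚ.- d)} {d ℚ.* (a ℚ.- b)} δ+δ≡ε
      (product-small {a} {c ℚ.- d} B>0 Bβ≡δ a<B c-d<β)
      (product-small {d} {a ℚ.- b} C>0 Cγ≡δ d<C a-b<γ))

cauchy-* : ∀ {x y} → Cauchy x → Cauchy y → Cauchy (λ n → x n ℚ.* y n)
cauchy-* {x} {y} cx cy ε ε>0 =
  let δ , δ>0 , δ+δ≡ε = half ε ε>0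
      B , B>0 , M₁ , bounded₁ = cauchy⇒bounded cx
      C , C>0 , M₂ , bounded₂ = cauchy⇒bounded cy
      β , β>0 , Bβ≡δ = divide B B>0 δ δ>0
      γ , γ>0 , Cγ≡δ = divide C C>0 δ δ>0
      N₁ , close₁ = cy β β>0
      N₂ , close₂ = cx γ γ>0
      M = M₁ ℕ.⊔ M₂
      N = N₁ ℕ.⊔ N₂
      M₁≤ = ℕ.≤-trans (ℕ.m≤m⊔n M₁ M₂) (ℕ.m≤m⊔n M N)
      M₂≤ = ℕ.≤-trans (ℕ.m≤n⊔m M₁ M₂) (ℕ.m≤m⊔n M N)
      N₁≤ = ℕ.≤-trans (ℕ.m≤m⊔n N₁ N₂) (ℕ.m≤n⊔m M N)
      N₂≤ = ℕ.≤-trans (ℕ.m≤n⊔m N₁ N₂) (ℕ.m≤n⊔m M N)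
  in M ℕ.⊔ N , λ m n p q →
       product-close {x m} {x n} {y m} {y n} B>0 C>0 Bβ≡δ Cγ≡δ δ+δ≡ε
         (bounded₁ m (ℕ.≤-trans M₁≤ p)) (bounded₂ n (ℕ.≤-trans M₂≤ q))
         (close₁ m n (ℕ.≤-trans N₁≤ p) (ℕ.≤-trans N₁≤ q))
         (close₂ m n (ℕ.≤-trans N₂≤ p) (ℕ.≤-trans N₂≤ q))

constant : ℚ → ℝ
seq    (constant q) _ = q
cauchy (constant q) ε ε>0 = 0 , λ _ _ _ _ →
  subst (λ p → ℚ.∣ p ∣ ℚ.< ε) (≡.sym (ℚ.+-inverseʳ q)) ε>0

infixl 6 _+ʳ_
infixl 7 _*ʳ_
infix 8 -ʳ_

_+ʳ_ : ℝ → ℝ → ℝ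
seq    (x +ʳ y) n = seq x n ℚ.+ seq y n
cauchy (x +ʳ y) = cauchy-+ {seq x} {seq y} (cauchy x) (cauchy y)

_*ʳ_ : ℝ → ℝ → ℝ
seq    (x *ʳ y) n = seq x n ℚ.* seq y n
cauchy (x *ʳ y) = cauchy-* {seq x} {seq y} (cauchy x) (cauchy y)

-ʳ_ : ℝ → ℝ
seq    (-ʳ x) n = ℚ.- seq x n
cauchy (-ʳ x) = cauchy-neg {seq x} (cauchy x)

termwise : ∀ {x y} → (∀ n → seq x n ≡ seq y n) → x ≈ʳ y
null (termwise {x} {y} x≗y) = null-≗
  (λ n → ≡.sym (≡.trans (cong (ℚ._- seq y n) (x≗y n)) (ℚ.+-inverseʳ (seq y n)))) null-0

≈ʳ-sym : ∀ {x y} → x ≈ʳ y → y ≈ʳ x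
null (≈ʳ-sym {x} {y} x≈y) = null-≗ (λ n → ℚI.neg-diff (seq x n) (seq y n)) (null-neg (null x≈y))

≈ʳ-trans : ∀ {x y z} → x ≈ʳ y → y ≈ʳ z → x ≈ʳ z
null (≈ʳ-trans {x} {y} {z} x≈y y≈z) = null-≗
  (λ n → ℚI.telescope (seq x n) (seq y n) (seq z n)) (null-+ (null x≈y) (null y≈z))

+ʳ-cong : ∀ {x x′ y y′} → x ≈ʳ x′ → y ≈ʳ y′ → x +ʳ y ≈ʳ x′ +ʳ y′
null (+ʳ-cong {x} {x′} {y} {y′} p q) = null-≗
  (λ n → ℚI.interchange (seq x n) (seq x′ n) (seq y n) (seq y′ n)) (null-+ (null p) (null q))

-ʳ-cong : ∀ {x y} → x ≈ʳ y → -ʳ x ≈ʳ -ʳ y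
null (-ʳ-cong {x} {y} p) = null-≗
  (λ n → ≡.trans (ℚI.neg-diff (seq x n) (seq y n)) (ℚI.diff-neg (seq x n) (seq y n)))
  (null-neg (null p))

*ʳ-cong : ∀ {x x′ y y′} → x ≈ʳ x′ → y ≈ʳ y′ → x *ʳ y ≈ʳ x′ *ʳ y′
null (*ʳ-cong {x} {x′} {y} {y′} p q) = null-≗
  (λ n → ℚI.product-diff (seq x n) (seq x′ n) (seq y n) (seq y′ n))
  (null-+ (null-* {seq x} (cauchy⇒bounded (cauchy x)) (null q))
          (null-* {seq y′} (cauchy⇒bounded (cauchy y′)) (null p)))

ℝ-commutativeRing : CommutativeRing 0ℓ 0ℓ
ℝ-commutativeRing = record
  { Carrier = ℝ
  ; _≈_ = _≈ʳ_
  ; _+_ = _+ʳ_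
  ; _*_ = _*ʳ_
  ; -_ = -ʳ_
  ; 0# = constant 0ℚ
  ; 1# = constant 1ℚ
  ; isCommutativeRing = record
    { isRing = record
      { +-isAbelianGroup = record
        { isGroup = record
          { isMonoid = record
            { isSemigroup = record
              { isMagma = record
                { isEquivalence = record
                  { refl = termwise λ _ → refl
                  ; sym = ≈ʳ-sym
                  ; trans = ≈ʳ-trans
                  }
                ; ∙-cong = +ʳ-cong
                }
              ; assoc = λ x y z → termwise λ n → ℚ.+-assoc (seq x n) (seq y n) (seq z n)
              }
            ; identity = (λ x → termwise λ n → ℚ.+-identityˡ (seq x n))
                       , (λ x → termwise λ n → ℚ.+-identityʳ (seq x n))
            }
          ; inverse = (λ x → termwise λ n → ℚ.+-inverseˡ (seq x n))
                    , (λ x → termwise λ n → ℚ.+-inverseʳ (seq x n))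
          ; ⁻¹-cong = -ʳ-cong
          }
        ; comm = λ x y → termwise λ n → ℚ.+-comm (seq x n) (seq y n)
        }
      ; *-cong = *ʳ-cong
      ; *-assoc = λ x y z → termwise λ n → ℚ.*-assoc (seq x n) (seq y n) (seq z n)
      ; *-identity = (λ x → termwise λ n → ℚ.*-identityˡ (seq x n))
                   , (λ x → termwise λ n → ℚ.*-identityʳ (seq x n))
      ; distrib = (λ x y z → termwise λ n → ℚ.*-distribˡ-+ (seq x n) (seq y n) (seq z n))
                , (λ x y z → termwise λ n → ℚ.*-distribʳ-+ (seq x n) (seq y n) (seq z n))
      }
    ; *-comm = λ x y → termwise λ n → ℚ.*-comm (seq x n) (seq y n)
    }
  }

record ℂ : Set where
  no-eta-equality
  field
    re im : ℝ

open ℂ public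

module R = CommutativeRing ℝ-commutativeRing

infixl 6 _+ᶜ_
infixl 7 _*ᶜ_
infix 8 -ᶜ_
infix 4 _≈ᶜ_

record _≈ᶜ_ (z w : ℂ) : Set where
  constructor _,_
  field
    re-≈ : re z ≈ʳ re w
    im-≈ : im z ≈ʳ im w

_+ᶜ_ : ℂ → ℂ → ℂ
re (z +ᶜ w) = re z +ʳ re w
im (z +ᶜ w) = im z +ʳ im w

_*ᶜ_ : ℂ → ℂ → ℂ
re (z *ᶜ w) = re z *ʳ re w +ʳ -ʳ (im z *ʳ im w)
im (z *ᶜ w) = re z *ʳ im w +ʳ im z *ʳ re w

-ᶜ_ : ℂ → ℂ
re (-ᶜ z) = -ʳ re z
im (-ᶜ z) = -ʳ im z

rational : ℚ → ℂ
re (rational q) = constant q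
im (rational q) = constant 0ℚ

*ᶜ-cong : ∀ {z z′ w w′} → z ≈ᶜ z′ → w ≈ᶜ w′ → z *ᶜ w ≈ᶜ z′ *ᶜ w′
*ᶜ-cong (p , q) (r , s) =
    R.+-cong (R.*-cong p r) (R.-‿cong (R.*-cong q s))
  , R.+-cong (R.*-cong p s) (R.*-cong q r)

*ᶜ-comm : ∀ z w → z *ᶜ w ≈ᶜ w *ᶜ z
*ᶜ-comm z w =
    R.+-cong (R.*-comm (re z) (re w)) (R.-‿cong (R.*-comm (im z) (im w)))
  , R.trans (R.+-comm (re z *ʳ im w) (im z *ʳ re w))
            (R.+-cong (R.*-comm (im z) (re w)) (R.*-comm (re z) (im w)))

*ᶜ-assoc : ∀ u v w → (u *ᶜ v) *ᶜ w ≈ᶜ u *ᶜ (v *ᶜ w)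
*ᶜ-assoc u v w =
    termwise (λ n → ℚI.assoc-re (seq (re u) n) (seq (im u) n) (seq (re v) n)
      (seq (im v) n) (seq (re w) n) (seq (im w) n))
  , termwise (λ n → ℚI.assoc-im (seq (re u) n) (seq (im u) n) (seq (re v) n)
      (seq (im v) n) (seq (re w) n) (seq (im w) n))

*ᶜ-identityˡ : ∀ z → rational 1ℚ *ᶜ z ≈ᶜ z
*ᶜ-identityˡ z =
    termwise (λ n → ℚI.identity-re (seq (re z) n) (seq (im z) n))
  , termwise (λ n → ℚI.identity-im (seq (re z) n) (seq (im z) n))

*ᶜ-distribˡ : ∀ u v w → u *ᶜ (v +ᶜ w) ≈ᶜ u *ᶜ v +ᶜ u *ᶜ w
*ᶜ-distribˡ u v w =
    termwise (λ n → ℚI.distrib-re (seq (re u) n) (seq (im u) n) (seq (re v) n)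
      (seq (im v) n) (seq (re w) n) (seq (im w) n))
  , termwise (λ n → ℚI.distrib-im (seq (re u) n) (seq (im u) n) (seq (re v) n)
      (seq (im v) n) (seq (re w) n) (seq (im w) n))

≈ᶜ-trans : ∀ {u v w} → u ≈ᶜ v → v ≈ᶜ w → u ≈ᶜ w
≈ᶜ-trans (p , q) (r , s) = R.trans p r , R.trans q s

+ᶜ-isAbelianGroup : IsAbelianGroup _≈ᶜ_ _+ᶜ_ (rational 0ℚ) -ᶜ_
+ᶜ-isAbelianGroup = record
  { isGroup = record
    { isMonoid = record
      { isSemigroup = record
        { isMagma = record
          { isEquivalence = record
            { refl = R.refl , R.refl
            ; sym = λ (p , q) → R.sym p , R.sym q
            ; trans = ≈ᶜ-trans
            }
          ; ∙-cong = λ (p , q) (r , s) → R.+-cong p r , R.+-cong q s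
          }
        ; assoc = λ u v w → R.+-assoc (re u) (re v) (re w) , R.+-assoc (im u) (im v) (im w)
        }
      ; identity = (λ z → R.+-identityˡ (re z) , R.+-identityˡ (im z))
                 , (λ z → R.+-identityʳ (re z) , R.+-identityʳ (im z))
      }
    ; inverse = (λ z → R.-‿inverseˡ (re z) , R.-‿inverseˡ (im z))
              , (λ z → R.-‿inverseʳ (re z) , R.-‿inverseʳ (im z))
    ; ⁻¹-cong = λ (p , q) → R.-‿cong p , R.-‿cong q
    }
  ; comm = λ z w → R.+-comm (re z) (re w) , R.+-comm (im z) (im w)
  }

ℂ-commutativeRing : CommutativeRing 0ℓ 0ℓ
ℂ-commutativeRing = record
  { Carrier = ℂ
  ; _≈_ = _≈ᶜ_
  ; _+_ = _+ᶜ_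
  ; _*_ = _*ᶜ_
  ; -_ = -ᶜ_
  ; 0# = rational 0ℚ
  ; 1# = rational 1ℚ
  ; isCommutativeRing = record
    { isRing = record
      { +-isAbelianGroup = +ᶜ-isAbelianGroup
      ; *-cong = *ᶜ-cong
      ; *-assoc = *ᶜ-assoc
      ; *-identity = *ᶜ-identityˡ
                   , λ z → ≈ᶜ-trans (*ᶜ-comm z (rational 1ℚ)) (*ᶜ-identityˡ z)
      ; distrib = *ᶜ-distribˡ
                , λ u v w → ≈ᶜ-trans (*ᶜ-comm (v +ᶜ w) u)
                    (≈ᶜ-trans (*ᶜ-distribˡ u v w)
                      (C+-cong (*ᶜ-comm u v) (*ᶜ-comm u w)))
      }
    ; *-comm = *ᶜ-comm
    }
  }
  where open IsAbelianGroup +ᶜ-isAbelianGroup using () renaming (∙-cong to C+-cong)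

open CommutativeRing ℂ-commutativeRing public
  using (_≈_; _≉_; _+_; _*_; -_; _-_; 0#; 1#)

module C = CommutativeRing ℂ-commutativeRing
module CP = RingProperties C.ring

𝐢 : ℂ
re 𝐢 = constant 0ℚ
im 𝐢 = constant 1ℚ

fromℕ : ℕ → ℂ
fromℕ n = n ·ⁿ 1#
  where open RawMonoidSum C.+-rawMonoid using () renaming (_×_ to _·ⁿ_)

VectorSpace : Set₁
VectorSpace = LeftModule C.ring 0ℓ 0ℓ

module _ (U : VectorSpace) where
  open LeftModule U
  open ModuleMorphism.LeftModuleMorphisms rawLeftModule rawLeftModule
    using (IsLeftModuleHomomorphism)
  open RawMonoidSum +ᴹ-rawMonoid using (sum)

  record LinearOperator : Set where
    field
      apply    : Carrierᴹ → Carrierᴹ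
      isLinear : IsLeftModuleHomomorphism apply

  combination : ∀ {n} → (Fin n → ℂ) → (Fin n → Carrierᴹ) → Carrierᴹ
  combination c b = sum (λ i → c i *ₗ b i)

  record IsBasis {n : ℕ} (b : Fin n → Carrierᴹ) : Set where
    field
      independent : ∀ c → combination c b ≈ᴹ 0ᴹ → ∀ i → c i ≈ 0#
      spanning    : ∀ u → ∃[ c ] (u ≈ᴹ combination c b)

  Represents : ∀ {n} → (Fin n → Carrierᴹ) → (Fin n → Fin n → ℂ) → LinearOperator → Set
  Represents b M L = ∀ j → LinearOperator.apply L (b j) ≈ᴹ combination (λ i → M i j) b

IsDiagonal : ∀ {n} → (Fin n → Fin n → ℂ) → Set
IsDiagonal M = ∀ i j → i ≢ j → M i j ≈ 0#

record IsTridiagonal {n : ℕ} (M : Fin n → Fin n → ℂ) : Set where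
  field
    banded : ∀ i j → M i j ≉ 0# →
      toℕ i ≡ toℕ j ⊎ toℕ i ≡ suc (toℕ j) ⊎ toℕ j ≡ suc (toℕ i)

record IsIrreducibleTridiagonal {n : ℕ} (M : Fin n → Fin n → ℂ) : Set where
  field
    isTridiagonal : IsTridiagonal M
    subdiagonal   : ∀ i j → toℕ i ≡ suc (toℕ j) → M i j ≉ 0#
    superdiagonal : ∀ i j → toℕ j ≡ suc (toℕ i) → M i j ≉ 0#

-- The dimension of U is suc d, so that U has finite positive dimension.
IsLeonardTriple : (U : VectorSpace) (L₁ L₂ L₃ : LinearOperator U) → Set
IsLeonardTriple U L₁ L₂ L₃ = ∃[ d ] (∀ (k : Fin 3) →
  Σ (Fin (suc d) → Carrierᴹ) λ b → IsBasis U b ×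
  Σ (Fin 3 → Fin (suc d) → Fin (suc d) → ℂ) λ M →
    (∀ l → Represents U b (M l) (L l)) ×
    IsDiagonal (M k) ×
    (∀ l → l ≢ k → IsIrreducibleTridiagonal (M l)))
  where
  open LeftModule U using (Carrierᴹ)
  L : Fin 3 → LinearOperator U
  L = L₁ Vector.∷ L₂ Vector.∷ L₃ Vector.∷ Vector.[]

record IsSubspace {X : Set} (W : Pred (X → ℂ) 0ℓ) : Set where
  field
    resp     : ∀ {v w} → (∀ y → v y ≈ w y) → v ∈ W → w ∈ W
    0-closed : (λ _ → 0#) ∈ W
    +-closed : ∀ {v w} → v ∈ W → w ∈ W → (λ y → v y + w y) ∈ W
    *-closed : ∀ c {v} → v ∈ W → (λ y → c * v y) ∈ W

subspace : {X : Set} (W : Pred (X → ℂ) 0ℓ) → IsSubspace W → VectorSpace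
subspace {X} W isSubspace = record
  { Carrierᴹ = ∃[ v ] (v ∈ W)
  ; _≈ᴹ_ = λ (v , _) (w , _) → ∀ y → v y ≈ w y
  ; _+ᴹ_ = λ (v , p) (w , q) → (λ y → v y + w y) , +-closed p q
  ; _*ₗ_ = λ c (v , p) → (λ y → c * v y) , *-closed c p
  ; 0ᴹ = (λ _ → 0#) , 0-closed
  ; -ᴹ_ = λ (v , p) → (λ y → - v y)
        , resp (λ y → CP.-1*x≈-x (v y)) (*-closed (- 1#) p)
  ; isLeftModule = record
    { isLeftSemimodule = record
      { +ᴹ-isCommutativeMonoid = record
        { isMonoid = record
          { isSemigroup = record
            { isMagma = record
              { isEquivalence = record
                { refl = λ _ → C.refl
                ; sym = λ p y → C.sym (p y)
                ; trans = λ p q y → C.trans (p y) (q y)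
                }
              ; ∙-cong = λ p q y → C.+-cong (p y) (q y)
              }
            ; assoc = λ (u , _) (v , _) (w , _) y → C.+-assoc (u y) (v y) (w y)
            }
          ; identity = (λ (v , _) y → C.+-identityˡ (v y))
                     , (λ (v , _) y → C.+-identityʳ (v y))
          }
        ; comm = λ (v , _) (w , _) y → C.+-comm (v y) (w y)
        }
      ; isPreleftSemimodule = record
        { *ₗ-cong = λ p q y → C.*-cong p (q y)
        ; *ₗ-zeroˡ = λ (v , _) y → C.zeroˡ (v y)
        ; *ₗ-distribʳ = λ (v , _) c d y → C.distribʳ (v y) c d
        ; *ₗ-identityˡ = λ (v , _) y → C.*-identityˡ (v y)
        ; *ₗ-assoc = λ c d (v , _) y → C.*-assoc c d (v y)
        ; *ₗ-zeroʳ = λ c y → C.zeroʳ c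
        ; *ₗ-distribˡ = λ c (v , _) (w , _) y → C.distribˡ c (v y) (w y)
        }
      }
    ; -ᴹ‿cong = λ p y → C.-‿cong (p y)
    ; -ᴹ‿inverse = (λ (v , _) y → C.-‿inverseˡ (v y))
                 , (λ (v , _) y → C.-‿inverseʳ (v y))
    }
  }
  where open IsSubspace isSubspace

Vertex : ℕ → Set
Vertex D = Vec Bool D

differences : ∀ {D} → Vertex D → Vertex D → ℕ
differences y z = ∣ zipWith _xor_ y z ∣

Adjacent : ∀ {D} → Vertex D → Vertex D → Set
Adjacent y z = differences y z ≡ 1

data Path {D : ℕ} : ℕ → Vertex D → Vertex D → Set where
  []  : ∀ {y} → Path 0 y y
  _∷_ : ∀ {n y z w} → Adjacent y z → Path n z w → Path (suc n) y w

IsPathDistance : ∀ {D} → Vertex D → Vertex D → ℕ → Set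
IsPathDistance y z n = Path n y z × (∀ m → Path m y z → n ℕ.≤ m)

differences-refl : ∀ {D} (y : Vertex D) → differences y y ≡ 0
differences-refl [] = refl
differences-refl (false ∷ y) = differences-refl y
differences-refl (true ∷ y) = differences-refl y

lift-adjacent : ∀ {D} a (y z : Vertex D) → Adjacent y z → Adjacent (a ∷ y) (a ∷ z)
lift-adjacent false y z e = e
lift-adjacent true y z e = e

lift-path : ∀ {D n} {y z : Vertex D} a → Path n y z → Path n (a ∷ y) (a ∷ z)
lift-path a [] = []
lift-path a (_∷_ {y = y} {z} e p) = lift-adjacent a y z e ∷ lift-path a p

shortest : ∀ {D} (y z : Vertex D) → Path (differences y z) y z
shortest [] [] = []
shortest (false ∷ y) (false ∷ z) = lift-path false (shortest y z)
shortest (true ∷ y) (true ∷ z) = lift-path true (shortest y z)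
shortest (false ∷ y) (true ∷ z) =
  cong suc (differences-refl y) ∷ lift-path true (shortest y z)
shortest (true ∷ y) (false ∷ z) =
  cong suc (differences-refl y) ∷ lift-path false (shortest y z)

triangle : ∀ {D} (y z w : Vertex D) →
           differences y w ℕ.≤ differences y z ℕ.+ differences z w
triangle [] [] [] = ℕ.z≤n
triangle (false ∷ y) (false ∷ z) (false ∷ w) = triangle y z w
triangle (true ∷ y) (true ∷ z) (true ∷ w) = triangle y z w
triangle (false ∷ y) (false ∷ z) (true ∷ w) = right y z w
  where
  right : ∀ {D} (y z w : Vertex D) →
          suc (differences y w) ℕ.≤ differences y z ℕ.+ suc (differences z w)
  right y z w rewrite ℕ.+-suc (differences y z) (differences z w) = ℕ.s≤s (triangle y z w)
triangle (true ∷ y) (true ∷ z) (false ∷ w)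
  rewrite ℕ.+-suc (differences y z) (differences z w) = ℕ.s≤s (triangle y z w)
triangle (false ∷ y) (true ∷ z) (true ∷ w) = ℕ.s≤s (triangle y z w)
triangle (true ∷ y) (false ∷ z) (false ∷ w) = ℕ.s≤s (triangle y z w)
triangle (false ∷ y) (true ∷ z) (false ∷ w) =
  ℕ.≤-trans (triangle y z w) (ℕ.≤-trans (ℕ.+-monoʳ-≤ (differences y z) (ℕ.n≤1+n _)) (ℕ.n≤1+n _))
triangle (true ∷ y) (false ∷ z) (true ∷ w) =
  ℕ.≤-trans (triangle y z w) (ℕ.≤-trans (ℕ.+-monoʳ-≤ (differences y z) (ℕ.n≤1+n _)) (ℕ.n≤1+n _))

differences≤length : ∀ {D m} {y z : Vertex D} → Path m y z → differences y z ℕ.≤ m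
differences≤length {y = y} [] = ℕ.≤-reflexive (differences-refl y)
differences≤length {z = w} (_∷_ {n} {y} {z} e p) = ℕ.≤-trans (triangle y z w)
  (subst (λ k → k ℕ.+ differences z w ℕ.≤ suc n) (≡.sym e) (ℕ.s≤s (differences≤length p)))

pathDistance : ∀ {D} (y z : Vertex D) → ∃[ n ] IsPathDistance y z n
pathDistance y z = differences y z , shortest y z , λ _ → differences≤length

∂ : ∀ {D} → Vertex D → Vertex D → ℕ
∂ y z = proj₁ (pathDistance y z)

∑ : ∀ {D} → (Vertex D → ℂ) → ℂ
∑ {zero}  f = f []
∑ {suc D} f = ∑ (λ y → f (false ∷ y)) + ∑ (λ y → f (true ∷ y))

∑-cong : ∀ {D} {f g : Vertex D → ℂ} → (∀ y → f y ≈ g y) → ∑ f ≈ ∑ g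
∑-cong {zero} f≈g = f≈g []
∑-cong {suc D} f≈g =
  C.+-cong (∑-cong λ y → f≈g (false ∷ y)) (∑-cong λ y → f≈g (true ∷ y))

∑-+ : ∀ {D} (f g : Vertex D → ℂ) → ∑ (λ y → f y + g y) ≈ ∑ f + ∑ g
∑-+ {zero} f g = C.refl
∑-+ {suc D} f g = C.trans (C.+-cong (∑-+ f₀ g₀) (∑-+ f₁ g₁))
    (CS.interchange (∑ f₀) (∑ g₀) (∑ f₁) (∑ g₁))
  where
  module CS = CommutativeSemigroupProperties C.+-commutativeSemigroup
  f₀ = λ y → f (false ∷ y)
  f₁ = λ y → f (true ∷ y)
  g₀ = λ y → g (false ∷ y)
  g₁ = λ y → g (true ∷ y)

∑-* : ∀ {D} c (f : Vertex D → ℂ) → ∑ (λ y → c * f y) ≈ c * ∑ f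
∑-* {zero} c f = C.refl
∑-* {suc D} c f = C.trans (C.+-cong (∑-* c f₀) (∑-* c f₁)) (C.sym (C.distribˡ c (∑ f₀) (∑ f₁)))
  where
  f₀ = λ y → f (false ∷ y)
  f₁ = λ y → f (true ∷ y)

V : ℕ → Set
V D = Vertex D → ℂ

Mat : ℕ → Set
Mat D = Vertex D → Vertex D → ℂ

module _ {D : ℕ} where

  infixl 6 _+ᴹ_ _-ᴹ_
  infixl 7 _*ᴹ_
  infixr 7 _·ᴹ_ _·ⱽ_
  infix 4 _≈ᴹ_

  _≈ᴹ_ : Mat D → Mat D → Set
  M ≈ᴹ N = ∀ y z → M y z ≈ N y z

  Iᴹ : Mat D
  Iᴹ y z = if does (Vec.≡-dec Bool._≟_ y z) then 1# else 0#

  _+ᴹ_ _-ᴹ_ _*ᴹ_ : Mat D → Mat D → Mat D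
  (M +ᴹ N) y z = M y z + N y z
  (M -ᴹ N) y z = M y z - N y z
  (M *ᴹ N) y z = ∑ (λ w → M y w * N w z)

  _·ᴹ_ : ℂ → Mat D → Mat D
  (c ·ᴹ M) y z = c * M y z

  _·ⱽ_ : Mat D → V D → V D
  (M ·ⱽ v) y = ∑ (λ z → M y z * v z)

  origin : Vertex D
  origin = replicate D false

  A : Mat D
  A y z = if does (differences y z ℕ.≟ 1) then 1# else 0#

  A* : Mat D
  A* y z = if does (Vec.≡-dec Bool._≟_ y z)
    then fromℕ D - fromℕ (2 ℕ.* ∂ origin y) else 0#

  Aᵋ : Mat D
  Aᵋ = (- 𝐢 * rational ½) ·ᴹ (A *ᴹ A* -ᴹ A* *ᴹ A)

  data T : Pred (Mat D) 0ℓ where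
    A∈T      : A ∈ T
    A*∈T     : A* ∈ T
    I∈T      : Iᴹ ∈ T
    +-closed : ∀ {M N} → M ∈ T → N ∈ T → M +ᴹ N ∈ T
    *-closed : ∀ {M N} → M ∈ T → N ∈ T → M *ᴹ N ∈ T
    ·-closed : ∀ c {M} → M ∈ T → c ·ᴹ M ∈ T
    resp     : ∀ {M N} → M ≈ᴹ N → M ∈ T → N ∈ T

  Aᵋ∈T : Aᵋ ∈ T
  Aᵋ∈T = ·-closed (- 𝐢 * rational ½)
    (resp (λ y z → C.+-congˡ (CP.-1*x≈-x ((A* *ᴹ A) y z)))
      (+-closed (*-closed A∈T A*∈T) (·-closed (- 1#) (*-closed A*∈T A∈T))))

  record IsTModule (W : Pred (V D) 0ℓ) : Set where
    field
      isSubspace : IsSubspace W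
      T-closed   : ∀ {B v} → B ∈ T → v ∈ W → B ·ⱽ v ∈ W

  -- Applied to the T-modules { w ∈ W ∣ w ≈ 0 ⊎ P }, the disjunction in minimal
  -- decides every P : Set, so classical reasoning about an irreducible T-module
  -- needs no separate excluded-middle hypothesis.
  record IsIrreducibleTModule (W : Pred (V D) 0ℓ) : Set₁ where
    field
      isTModule : IsTModule W
      nonzero   : ∃[ v ] (v ∈ W × ¬ (∀ y → v y ≈ 0#))
      minimal   : ∀ {U : Pred (V D) 0ℓ} → IsTModule U → U ⊆ W →
                  (∀ {v} → v ∈ U → ∀ y → v y ≈ 0#) ⊎ W ⊆ U

  ·ⱽ-+ : ∀ (M : Mat D) v w y → (M ·ⱽ (λ z → v z + w z)) y ≈ (M ·ⱽ v) y + (M ·ⱽ w) y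
  ·ⱽ-+ M v w y = C.trans (∑-cong λ z → C.distribˡ (M y z) (v z) (w z))
    (∑-+ (λ z → M y z * v z) (λ z → M y z * w z))

  ·ⱽ-* : ∀ (M : Mat D) c v y → (M ·ⱽ (λ z → c * v z)) y ≈ c * (M ·ⱽ v) y
  ·ⱽ-* M c v y = C.trans (∑-cong λ z → CS.x∙yz≈y∙xz (M y z) c (v z))
    (∑-* c (λ z → M y z * v z))
    where module CS = CommutativeSemigroupProperties C.*-commutativeSemigroup

  ·ⱽ-0 : ∀ (M : Mat D) y → (M ·ⱽ (λ _ → 0#)) y ≈ 0#
  ·ⱽ-0 M y = C.trans (∑-cong {D} λ z → C.trans (C.zeroʳ (M y z)) (C.sym (C.zeroˡ 0#)))
    (C.trans (∑-* {D} 0# (λ _ → 0#)) (C.zeroˡ (∑ {D} λ _ → 0#)))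

  ·ⱽ-neg : ∀ (M : Mat D) v y → (M ·ⱽ (λ z → - v z)) y ≈ - (M ·ⱽ v) y
  ·ⱽ-neg M v y = C.trans
    (∑-cong λ z → C.*-congˡ (C.sym (CP.-1*x≈-x (v z))))
    (C.trans (·ⱽ-* M (- 1#) v y) (CP.-1*x≈-x ((M ·ⱽ v) y)))

  module _ {W : Pred (V D) 0ℓ} (isTModule : IsTModule W) where
    open IsTModule isTModule

    vectorSpace : VectorSpace
    vectorSpace = subspace W isSubspace

    restrict : (B : Mat D) → B ∈ T → LinearOperator vectorSpace
    restrict B B∈T = record
      { apply = λ (v , v∈W) → B ·ⱽ v , T-closed B∈T v∈W
      ; isLinear = record
        { +ᴹ-isGroupHomomorphism = record
          { isMonoidHomomorphism = record
            { isMagmaHomomorphism = record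
              { isRelHomomorphism = record
                { cong = λ v≈w y → ∑-cong λ z → C.*-congˡ (v≈w z) }
              ; homo = λ (v , _) (w , _) → ·ⱽ-+ B v w
              }
            ; ε-homo = ·ⱽ-0 B
            }
          ; ⁻¹-homo = λ (v , _) → ·ⱽ-neg B v
          }
        ; *ₗ-homo = λ c (v , _) → ·ⱽ-* B c v
        }
      }

-- Writing Δ m for the sum over the coordinates of the 2×2 matrix m acting on that
-- coordinate, A, A* and Aᵋ are Δ σ for three Pauli matrices σ, so L₀ = A, L₁ = A*,
-- L₂ = Aᵋ satisfy [Lₖ₊₁, Lₖ₊₂] = 2i Lₖ (indices mod 3).  For each k this makes
-- H = Lₖ, E = (Lₖ₊₁ + i Lₖ₊₂)/2, F = (Lₖ₊₁ - i Lₖ₊₂)/2 an sl₂-triple with E and F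
-- nilpotent.  On ker E one has E Fⁿ⁺¹ = (n+1) Fⁿ (H - n); hence EⁿFⁿ is a multiple of
-- H (H - 1) ⋯ (H - n + 1) there, and nilpotency yields an eigenvector v of H in ker E whose
-- eigenvalue d is the natural number with Fᵈv ≠ 0 = Fᵈ⁺¹v.  By irreducibility
-- v, Fv, …, Fᵈv is a basis of W; in it H is diagonal, and Lₖ₊₁ = E + F and
-- Lₖ₊₂ = -i E + i F are irreducible tridiagonal.  Finally d does not depend on k, since the
-- Casimir operator A² + A*² + (Aᵋ)² acts as d² + 2d.

module Submission where

open import Defs
open import Data.Nat.Base using (ℕ; NonZero)
open import Level using (0ℓ)
open import Relation.Unary using (Pred)

open import Algebra.Bundles using (RawRing)
open import Algebra.Module.Bundles using (LeftModule)
open import Algebra.Module.Morphism.Structures using (module LeftModuleMorphisms)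
import Algebra.Properties.Ring as RingProperties
import Algebra.Solver.Ring
open import Algebra.Solver.Ring.AlmostCommutativeRing using (fromCommutativeRing; _-Raw-AlmostCommutative⟶_)
open import Axiom.ExcludedMiddle using (ExcludedMiddle)
open import Data.Bool.Base using (Bool; true; false; if_then_else_)
import Data.Bool.Properties as Bool
open import Data.Empty using (⊥-elim)
open import Data.Fin.Base using (Fin; zero; suc; toℕ)
import Data.Fin.Properties as Fin
open import Data.Maybe.Base using (Maybe; just; nothing)
open import Data.Nat.Base as ℕ using (zero; suc; z≤n; s≤s)
import Data.Nat.Properties as ℕ
open import Data.Product.Base using (Σ; ∃-syntax; _×_; _,_; proj₁; proj₂)
open import Data.Product.Properties using (≡-dec)
open import Data.Rational.Base as ℚ using (ℚ; 0ℚ; 1ℚ; ½)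
import Data.Rational.Properties as ℚ
import Data.Rational.Solver as ℚ
open import Data.Sum.Base as Sum using (_⊎_; inj₁; inj₂; [_,_]′)
open import Data.Vec.Base using ([]; _∷_)
import Data.Vec.Functional as Vector
import Data.Vec.Properties as Vec
open import Function.Base using (_∘_)
open import Relation.Binary.Bundles using (Setoid)
open import Relation.Binary.Definitions using (DecidableEquality)
open import Relation.Binary.PropositionalEquality as ≡ using (_≡_; _≢_; refl; cong; subst)
import Relation.Binary.Reasoning.Setoid as SetoidReasoning
open import Relation.Nullary using (¬_; Dec; yes; no; does)
open import Relation.Nullary.Decidable using (from-yes; map′; _×-dec_)
open import Relation.Unary using (_∈_; _⊆_)

-- Two properties of ℂ carry the argument: characteristic zero, and the absence of zero divisors,
-- which for Cauchy sequences is proved from the excluded middle that irreducibility supplies.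
-- Nilpotency comes from the cube: the 2×2 matrices behind E and F square to zero, and in a product
-- of D + 1 factors, each acting on one of D coordinates, some coordinate is hit twice. This bound
-- is the source of highest weight vectors: the linear factors of EⁿFⁿ are tried one after another
-- until one of them kills a vector. Apart from the excluded middle, irreducibility is used in a
-- single form: a property closed under linear combinations and the three operators that holds for
-- one nonzero vector holds for all. It is applied to the span of v, Fv, ..., Fᵈv and to the
-- eigenspace of the Casimir operator.

-- Gaussian rationals

𝔾 : Set
𝔾 = ℚ × ℚ

infix 4 _≟ᵍ_
_≟ᵍ_ : DecidableEquality 𝔾
_≟ᵍ_ = ≡-dec ℚ._≟_ ℚ._≟_

-- The pair `(p , q)` is p + q i. Decidable equality makes these the coefficients of the ring solver
-- and allows identities of Pauli matrices to be checked by evaluation. The product copies the shape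
-- of `_*ᶜ_`, so that `gaussian` is a homomorphism termwise by `refl`.
𝔾-rawRing : RawRing 0ℓ 0ℓ
𝔾-rawRing = record
  { Carrier = 𝔾
  ; _≈_ = _≡_
  ; _+_ = λ (p , q) (r , s) → p ℚ.+ r , q ℚ.+ s
  ; _*_ = λ (p , q) (r , s) → p ℚ.* r ℚ.+ ℚ.- (q ℚ.* s) , p ℚ.* s ℚ.+ q ℚ.* r
  ; -_  = λ (p , q) → ℚ.- p , ℚ.- q
  ; 0#  = 0ℚ , 0ℚ
  ; 1#  = 1ℚ , 0ℚ
  }

module 𝔾 = RawRing 𝔾-rawRing

gaussian : 𝔾 → ℂ
re (gaussian (p , q)) = constant p
im (gaussian (p , q)) = constant q

gaussian-homomorphism : 𝔾-rawRing -Raw-AlmostCommutative⟶ fromCommutativeRing ℂ-commutativeRing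
gaussian-homomorphism = record
  { ⟦_⟧    = gaussian
  ; +-homo = λ _ _ → termwise (λ _ → refl) , termwise (λ _ → refl)
  ; *-homo = λ _ _ → termwise (λ _ → refl) , termwise (λ _ → refl)
  ; -‿homo = λ _ → termwise (λ _ → refl) , termwise (λ _ → refl)
  ; 0-homo = termwise (λ _ → refl) , termwise (λ _ → refl)
  ; 1-homo = termwise (λ _ → refl) , termwise (λ _ → refl)
  }

module G = _-Raw-AlmostCommutative⟶_ gaussian-homomorphism

gaussian-≟ : ∀ p q → Maybe (gaussian p ≈ gaussian q)
gaussian-≟ p q with p ≟ᵍ q
... | yes p≡q = just (C.reflexive (cong gaussian p≡q))
... | no  _   = nothing

module Solver = Algebra.Solver.Ring 𝔾-rawRing
  (fromCommutativeRing ℂ-commutativeRing) gaussian-homomorphism gaussian-≟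

0ᵍ ½ᵍ 1ᵍ 2ᵍ iᵍ ½iᵍ 2iᵍ : 𝔾
0ᵍ = 0ℚ , 0ℚ
½ᵍ = ½ , 0ℚ
1ᵍ = 1ℚ , 0ℚ
2ᵍ = 1ᵍ 𝔾.+ 1ᵍ
iᵍ = 0ℚ , 1ℚ
½iᵍ = 0ℚ , ½
2iᵍ = iᵍ 𝔾.+ iᵍ


-- Zero divisors

≈0⇒null : ∀ {x} → x R.≈ R.0# → Null (seq x)
≈0⇒null {x} x≈0 = null-≗ (λ n → ℚ.+-identityʳ (seq x n)) (null x≈0)

null⇒≈0 : ∀ {x} → Null (seq x) → x R.≈ R.0#
null (null⇒≈0 {x} nx) = null-≗ (λ n → ≡.sym (ℚ.+-identityʳ (seq x n))) nx

AwayFromZero : (ℕ → ℚ) → Set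
AwayFromZero x = ∃[ δ ] (0ℚ ℚ.< δ × ∃[ N ] (∀ n → N ℕ.≤ n → δ ℚ.≤ ℚ.∣ x n ∣))

large-stays-large : ∀ {a b δ ε} → δ ℚ.+ δ ≡ ε → ε ℚ.≤ ℚ.∣ a ∣ → ℚ.∣ b ℚ.- a ∣ ℚ.< δ → δ ℚ.≤ ℚ.∣ b ∣
large-stays-large {a} {b} {δ} {ε} δ+δ≡ε ε≤a b-a<δ = ℚ.≮⇒≥ λ b<δ → ℚ.<-irrefl refl
  (ℚ.≤-<-trans ε≤a (subst (λ p → ℚ.∣ p ∣ ℚ.< ε) (ℚI.b+[a-b] a b)
    (sum-small {b} {a ℚ.- b} δ+δ≡ε b<δ (subst (ℚ._< δ) ∣b-a∣≡∣a-b∣ b-a<δ))))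
  where
  ∣b-a∣≡∣a-b∣ : ℚ.∣ b ℚ.- a ∣ ≡ ℚ.∣ a ℚ.- b ∣
  ∣b-a∣≡∣a-b∣ = ≡.trans (≡.sym (ℚ.∣-p∣≡∣p∣ (b ℚ.- a))) (cong ℚ.∣_∣ (ℚI.neg-diff b a))

-- If a late term had size at least ε, the Cauchy property for ε/2 would keep all later terms at
-- size at least ε/2, and the sequence would be away from zero.
null-or-away : ExcludedMiddle 0ℓ → ∀ {x} → Cauchy x → Null x ⊎ AwayFromZero x
null-or-away em {x} cx with em {AwayFromZero x}
... | yes away = inj₂ away
... | no ¬away = inj₁ λ ε ε>0 →
  let δ , δ>0 , δ+δ≡ε = half ε ε>0
      N , close = cx δ δ>0
  in N , λ n N≤n → ℚ.≰⇒> λ ε≤xn → ¬away (δ , δ>0 , N , λ m N≤m →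
    large-stays-large {x n} {x m} δ+δ≡ε ε≤xn (close m n N≤m N≤n))

null-cancel : ∀ {x y : ℕ → ℚ} → AwayFromZero x → Null (λ n → x n ℚ.* y n) → Null y
null-cancel {x} {y} (δ , δ>0 , M , δ≤x) nxy ε ε>0 =
  let N , small = nxy (δ ℚ.* ε) δε>0
  in M ℕ.⊔ N , λ n M⊔N≤n → ℚ.*-cancelˡ-<-nonNeg δ (ℚ.≤-<-trans
       (ℚ.*-monoʳ-≤-nonNeg ℚ.∣ y n ∣ {{ℚ.∣-∣-nonNeg (y n)}} (δ≤x n (ℕ.≤-trans (ℕ.m≤m⊔n M N) M⊔N≤n)))
       (subst (ℚ._< δ ℚ.* ε) (ℚ.∣p*q∣≡∣p∣*∣q∣ (x n) (y n)) (small n (ℕ.≤-trans (ℕ.m≤n⊔m M N) M⊔N≤n))))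
  where
  instance
    _ = ℚ.positive δ>0
    _ = ℚ.pos⇒nonNeg δ
  δε>0 : 0ℚ ℚ.< δ ℚ.* ε
  δε>0 = subst (ℚ._< δ ℚ.* ε) (ℚ.*-zeroʳ δ) (ℚ.*-monoʳ-<-pos δ ε>0)

ℝ-noZeroDivisors : ExcludedMiddle 0ℓ → ∀ x y → x R.* y R.≈ R.0# → x R.≈ R.0# ⊎ y R.≈ R.0#
ℝ-noZeroDivisors em x y xy≈0 = Sum.map null⇒≈0
  (λ away → null⇒≈0 (null-cancel {seq x} {seq y} away (≈0⇒null xy≈0)))
  (null-or-away em (cauchy x))

∣p∣*∣p∣≡p*p : ∀ p → ℚ.∣ p ∣ ℚ.* ℚ.∣ p ∣ ≡ p ℚ.* p
∣p∣*∣p∣≡p*p p with ℚ.∣p∣≡p∨∣p∣≡-p p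
... | inj₁ ∣p∣≡p  = ≡.cong₂ ℚ._*_ ∣p∣≡p ∣p∣≡p
... | inj₂ ∣p∣≡-p = ≡.trans (≡.cong₂ ℚ._*_ ∣p∣≡-p ∣p∣≡-p) (-p*-p≡p*p p)
  where
  open ℚ.+-*-Solver
  -p*-p≡p*p : ∀ p → (ℚ.- p) ℚ.* (ℚ.- p) ≡ p ℚ.* p
  -p*-p≡p*p = solve 1 (λ p → (:- p) :* (:- p) := p :* p) refl

∣p∣*∣p∣≤∣p*p+q*q∣ : ∀ p q → ℚ.∣ p ∣ ℚ.* ℚ.∣ p ∣ ℚ.≤ ℚ.∣ p ℚ.* p ℚ.+ q ℚ.* q ∣
∣p∣*∣p∣≤∣p*p+q*q∣ p q = begin
  ∣p∣²                        ≡⟨ ℚ.+-identityʳ ∣p∣² ⟨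
  ∣p∣² ℚ.+ 0ℚ                 ≤⟨ ℚ.+-monoʳ-≤ ∣p∣² (ℚ.nonNegative⁻¹ ∣q∣²) ⟩
  ∣p∣² ℚ.+ ∣q∣²               ≡⟨ ℚ.0≤p⇒∣p∣≡p (ℚ.nonNegative⁻¹ (∣p∣² ℚ.+ ∣q∣²)) ⟨
  ℚ.∣ ∣p∣² ℚ.+ ∣q∣² ∣         ≡⟨ cong ℚ.∣_∣ (≡.cong₂ ℚ._+_ (∣p∣*∣p∣≡p*p p) (∣p∣*∣p∣≡p*p q)) ⟩
  ℚ.∣ p ℚ.* p ℚ.+ q ℚ.* q ∣   ∎
  where
  open ℚ.≤-Reasoning
  ∣p∣² = ℚ.∣ p ∣ ℚ.* ℚ.∣ p ∣
  ∣q∣² = ℚ.∣ q ∣ ℚ.* ℚ.∣ q ∣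
  instance
    _ = ℚ.∣-∣-nonNeg p
    _ = ℚ.∣-∣-nonNeg q
    ∣p∣²-nonNeg = ℚ.nonNeg*nonNeg⇒nonNeg ℚ.∣ p ∣ ℚ.∣ p ∣
    ∣q∣²-nonNeg = ℚ.nonNeg*nonNeg⇒nonNeg ℚ.∣ q ∣ ℚ.∣ q ∣
    _ = ℚ.nonNeg+nonNeg⇒nonNeg ∣p∣² ∣q∣²

sum-of-squares-null : ∀ {x y : ℕ → ℚ} → Null (λ n → x n ℚ.* x n ℚ.+ y n ℚ.* y n) → Null x
sum-of-squares-null {x} {y} n² ε ε>0 with n² (ε ℚ.* ε) ε²>0
  where
  instance _ = ℚ.positive ε>0
  ε²>0 : 0ℚ ℚ.< ε ℚ.* ε
  ε²>0 = subst (ℚ._< ε ℚ.* ε) (ℚ.*-zeroʳ ε) (ℚ.*-monoʳ-<-pos ε ε>0)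
... | N , small = N , λ n N≤n → ℚ.≰⇒> λ ε≤xn → ℚ.<-irrefl refl
  (ℚ.≤-<-trans (ε²≤ n ε≤xn) (ℚ.≤-<-trans (∣p∣*∣p∣≤∣p*p+q*q∣ (x n) (y n)) (small n N≤n)))
  where
  ε²≤ : ∀ n → ε ℚ.≤ ℚ.∣ x n ∣ → ε ℚ.* ε ℚ.≤ ℚ.∣ x n ∣ ℚ.* ℚ.∣ x n ∣
  ε²≤ n ε≤xn = ℚ.≤-trans (ℚ.*-monoˡ-≤-nonNeg ε ε≤xn)
    (ℚ.*-monoʳ-≤-nonNeg ℚ.∣ x n ∣ ε≤xn)
    where instance
      _ = ℚ.∣-∣-nonNeg (x n)
      ε-pos = ℚ.positive ε>0
      _ = ℚ.pos⇒nonNeg ε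

norm² : ℂ → ℝ
norm² z = re z *ʳ re z +ʳ im z *ʳ im z

-- The Brahmagupta-Fibonacci identity. It turns a vanishing product in ℂ into a vanishing product in
-- ℝ, and a vanishing sum of two squares forces both to vanish.
norm²-* : ∀ z w → norm² z R.* norm² w R.≈ norm² (z * w)
norm²-* z w = termwise λ n →
  norm-product (seq (re z) n) (seq (im z) n) (seq (re w) n) (seq (im w) n)
  where
  open ℚ.+-*-Solver
  norm-product : ∀ a b c d →
    (a ℚ.* a ℚ.+ b ℚ.* b) ℚ.* (c ℚ.* c ℚ.+ d ℚ.* d) ≡
    (a ℚ.* c ℚ.+ ℚ.- (b ℚ.* d)) ℚ.* (a ℚ.* c ℚ.+ ℚ.- (b ℚ.* d)) ℚ.+
    (a ℚ.* d ℚ.+ b ℚ.* c) ℚ.* (a ℚ.* d ℚ.+ b ℚ.* c)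
  norm-product = solve 4 (λ a b c d →
    (a :* a :+ b :* b) :* (c :* c :+ d :* d) :=
    (a :* c :+ (:- (b :* d))) :* (a :* c :+ (:- (b :* d))) :+
    (a :* d :+ b :* c) :* (a :* d :+ b :* c)) refl

norm²-cong : ∀ {z w} → z ≈ w → norm² z R.≈ norm² w
norm²-cong (p , q) = R.+-cong (R.*-cong p p) (R.*-cong q q)

norm²≈0 : ∀ z → norm² z R.≈ R.0# → z ≈ 0#
norm²≈0 z n≈0 =
    null⇒≈0 (sum-of-squares-null {seq (re z)} {seq (im z)} (≈0⇒null n≈0))
  , null⇒≈0 (sum-of-squares-null {seq (im z)} {seq (re z)}
      (≈0⇒null (R.trans (R.+-comm (im z *ʳ im z) (re z *ʳ re z)) n≈0)))

ℂ-noZeroDivisors : ExcludedMiddle 0ℓ → ∀ z w → z * w ≈ 0# → z ≈ 0# ⊎ w ≈ 0#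
ℂ-noZeroDivisors em z w zw≈0 = Sum.map (norm²≈0 z) (norm²≈0 w)
  (ℝ-noZeroDivisors em (norm² z) (norm² w) (R.trans (norm²-* z w)
    (R.trans (norm²-cong zw≈0) (termwise λ _ → refl))))

-- Characteristic zero

natℚ : ℕ → ℚ
natℚ zero    = 0ℚ
natℚ (suc n) = 1ℚ ℚ.+ natℚ n

-- A constant sequence at each `n`, so injectivity is inherited from ℚ. For variable `n` the solver
-- sees an atom, and `nat-suc` has to be supplied to it as an equation.
nat : ℕ → ℂ
nat n = gaussian (natℚ n , 0ℚ)

nat-suc : ∀ n → nat (suc n) ≈ gaussian 1ᵍ + nat n
nat-suc n = termwise (λ _ → refl) , termwise (λ _ → refl)

0≤natℚ : ∀ n → 0ℚ ℚ.≤ natℚ n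
0≤natℚ zero    = ℚ.≤-refl
0≤natℚ (suc n) = ℚ.+-mono-≤ (ℚ.<⇒≤ 1>0) (0≤natℚ n)

natℚ-suc≢0 : ∀ n → natℚ (suc n) ≢ 0ℚ
natℚ-suc≢0 n e = ℚ.<-irrefl (≡.sym e) (ℚ.+-mono-<-≤ 1>0 (0≤natℚ n))

natℚ-injective : ∀ {m n} → natℚ m ≡ natℚ n → m ≡ n
natℚ-injective {zero}  {zero}  e = refl
natℚ-injective {zero}  {suc n} e = ⊥-elim (natℚ-suc≢0 n (≡.sym e))
natℚ-injective {suc m} {zero}  e = ⊥-elim (natℚ-suc≢0 m e)
natℚ-injective {suc m} {suc n} e = cong suc (natℚ-injective (ℚ+.+-cancelˡ 1ℚ (natℚ m) (natℚ n) e))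
  where module ℚ+ = RingProperties ℚ.+-*-ring

constant-injective : ∀ {p q} → constant p R.≈ constant q → p ≡ q
constant-injective {p} {q} p≈q with p ℚ.≟ q
... | yes p≡q = p≡q
... | no  p≢q = ⊥-elim (contra (null p≈q ε ε>0))
  where
  -- The distance itself is the tolerance: a null constant sequence would give ε < ε.
  ε = ℚ.∣ p ℚ.- q ∣
  ε>0 : 0ℚ ℚ.< ε
  ε>0 = ℚ.≰⇒> λ ε≤0 → p≢q (p-q≡0⇒p≡q (ℚ.∣p∣≡0⇒p≡0 (p ℚ.- q) (ℚ.≤-antisym ε≤0 (ℚ.0≤∣p∣ (p ℚ.- q)))))
    where
    p-q≡0⇒p≡q : p ℚ.- q ≡ 0ℚ → p ≡ q
    p-q≡0⇒p≡q e = ≡.trans (≡.sym (ℚI.b+[a-b] p q)) (≡.trans (cong (q ℚ.+_) e) (ℚ.+-identityʳ q))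
  contra : ¬ (∃[ N ] (∀ n → N ℕ.≤ n → ε ℚ.< ε))
  contra (N , small) = ℚ.<-irrefl refl (small N ℕ.≤-refl)

gaussian-injective : ∀ {p q} → gaussian p ≈ gaussian q → p ≡ q
gaussian-injective (r , s) = ≡.cong₂ _,_ (constant-injective r) (constant-injective s)

nat-injective : ∀ {m n} → nat m ≈ nat n → m ≡ n
nat-injective m≈n = natℚ-injective (cong proj₁ (gaussian-injective m≈n))

nat-suc≉0 : ∀ n → nat (suc n) ≉ 0#
nat-suc≉0 n (r , _) = natℚ-suc≢0 n (constant-injective r)

gaussian≉0 : ∀ {p} → p ≢ 0ᵍ → gaussian p ≉ 0#
gaussian≉0 p≢0 p≈0 = p≢0 (gaussian-injective (C.trans p≈0 (C.sym G.0-homo)))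

open Solver using (solve; con; _:+_; _:*_; _:-_; :-_; _:=_)

½c 1c 2c ic ½ic 2ic : ℂ
½c = gaussian ½ᵍ
1c = gaussian 1ᵍ
2c = gaussian 2ᵍ
ic = gaussian iᵍ
½ic = gaussian ½iᵍ
2ic = gaussian 2iᵍ

1c*z≈z : ∀ z → 1c * z ≈ z
1c*z≈z = solve 1 (λ z → con 1ᵍ :* z := z) C.refl

-- Applies when a - b = c (l - r), stated without subtraction.
using-equation : ∀ {a b l r} c → l ≈ r → a + c * r ≈ b + c * l → a ≈ b
using-equation {a} {b} {l} {r} c l≈r h =
  CP.+-cancelʳ (c * r) a b (C.trans h (C.+-congˡ (C.*-congˡ l≈r)))

module _ {A : Set} (f : A → A) where

  -- The additional factor is applied first, so `pow (suc n) u` is `pow n (f u)` by definition: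
  -- shifting a sequence of powers amounts to changing its starting point.
  pow : ℕ → A → A
  pow zero    u = u
  pow (suc n) u = pow n (f u)

  pow-suc : ∀ n u → pow (suc n) u ≡ f (pow n u)
  pow-suc zero    u = refl
  pow-suc (suc n) u = pow-suc n (f u)

  pow-comm : ∀ m n u → pow m (pow n u) ≡ pow n (pow m u)
  pow-comm m zero    u = refl
  pow-comm m (suc n) u = ≡.trans (pow-comm m n (f u)) (cong (pow n) (pow-suc m u))

next : Fin 3 → Fin 3
next zero             = suc zero
next (suc zero)       = suc (suc zero)
next (suc (suc zero)) = zero

-- The position of an index relative to `k` in the cyclic order; matching on it leaves three cases
-- instead of nine.
data Role (k : Fin 3) : Fin 3 → Set where
  itself   : Role k k
  first    : Role k (next k)
  second   : Role k (next (next k))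

role : ∀ k l → Role k l
role zero             zero             = itself
role zero             (suc zero)       = first
role zero             (suc (suc zero)) = second
role (suc zero)       zero             = second
role (suc zero)       (suc zero)       = itself
role (suc zero)       (suc (suc zero)) = first
role (suc (suc zero)) zero             = first
role (suc (suc zero)) (suc zero)       = second
role (suc (suc zero)) (suc (suc zero)) = itself

role-itself : ∀ k → role k k ≡ itself
role-itself zero             = refl
role-itself (suc zero)       = refl
role-itself (suc (suc zero)) = refl

-- Linear algebra in a subspace

module Representation (em : ExcludedMiddle 0ℓ) {X : Set} (W : Pred (X → ℂ) 0ℓ)
  (isSubspace : IsSubspace W) where

  U : VectorSpace
  U = subspace W isSubspace

  open LeftModule U public using (Carrierᴹ; _*ₗ_)
    renaming (_+ᴹ_ to _⊕_; 0ᴹ to 0ᵁ; _≈ᴹ_ to _≈ᵁ_)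

  -- A record, so that u and w can be inferred from u ≋ w.
  infix 4 _≋_
  record _≋_ (u w : Carrierᴹ) : Set where
    constructor pointwise
    field at : u ≈ᵁ w

  open _≋_ public

  ≋-setoid : Setoid 0ℓ 0ℓ
  ≋-setoid = record
    { Carrier = Carrierᴹ
    ; _≈_ = _≋_
    ; isEquivalence = record
      { refl  = pointwise λ _ → C.refl
      ; sym   = λ p → pointwise λ y → C.sym (at p y)
      ; trans = λ p q → pointwise λ y → C.trans (at p y) (at q y)
      }
    }

  open Setoid ≋-setoid public using ()
    renaming (refl to ≋-refl; sym to ≋-sym; trans to ≋-trans; reflexive to ≋-reflexive)
  open SetoidReasoning ≋-setoid

  ⊕-cong : ∀ {u u′ w w′} → u ≋ u′ → w ≋ w′ → u ⊕ w ≋ u′ ⊕ w′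
  ⊕-cong p q = pointwise λ y → C.+-cong (at p y) (at q y)

  *ₗ-cong : ∀ {a b u w} → a ≈ b → u ≋ w → a *ₗ u ≋ b *ₗ w
  *ₗ-cong p q = pointwise λ y → C.*-cong p (at q y)

  *ₗ-zeroˡ : ∀ u → 0# *ₗ u ≋ 0ᵁ
  *ₗ-zeroˡ u = pointwise λ y → C.zeroˡ (proj₁ u y)

  *ₗ-zeroʳ : ∀ c → c *ₗ 0ᵁ ≋ 0ᵁ
  *ₗ-zeroʳ c = pointwise λ _ → C.zeroʳ c

  ⊕-zero : ∀ {u w} → u ≋ 0ᵁ → w ≋ 0ᵁ → u ⊕ w ≋ 0ᵁ
  ⊕-zero p q = pointwise λ y → C.trans (C.+-cong (at p y) (at q y)) (C.+-identityˡ 0#)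

  -- The hypothesis on `u` exhibits no nonzero coordinate, so the case distinction is on `c`: if `c`
  -- is nonzero, every coordinate of `u` vanishes.
  *ₗ-torsionFree : ∀ {c u} → ¬ u ≋ 0ᵁ → c *ₗ u ≋ 0ᵁ → c ≈ 0#
  *ₗ-torsionFree {c} {u} u≉0 cu≈0 with em {c ≈ 0#}
  ... | yes c≈0 = c≈0
  ... | no  c≉0 = ⊥-elim (u≉0 (pointwise λ y →
    [ (λ c≈0 → ⊥-elim (c≉0 c≈0)) , (λ e → e) ]′ (ℂ-noZeroDivisors em c (proj₁ u y) (at cu≈0 y))))

  record Linear (f : Carrierᴹ → Carrierᴹ) : Set where
    field
      f-cong : ∀ {u w} → u ≋ w → f u ≋ f w
      ⊕-homo : ∀ u w → f (u ⊕ w) ≋ f u ⊕ f w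
      *-homo : ∀ c u → f (c *ₗ u) ≋ c *ₗ f u

    0-homo : ∀ {u} → u ≋ 0ᵁ → f u ≋ 0ᵁ
    0-homo {u} u≈0 = begin
      f u          ≈⟨ f-cong (≋-trans u≈0 (≋-sym (*ₗ-zeroˡ 0ᵁ))) ⟩
      f (0# *ₗ 0ᵁ) ≈⟨ *-homo 0# 0ᵁ ⟩
      0# *ₗ f 0ᵁ   ≈⟨ *ₗ-zeroˡ (f 0ᵁ) ⟩
      0ᵁ           ∎

    lincomb : ∀ a u b w → f (a *ₗ u ⊕ b *ₗ w) ≋ a *ₗ f u ⊕ b *ₗ f w
    lincomb a u b w = ≋-trans (⊕-homo (a *ₗ u) (b *ₗ w)) (⊕-cong (*-homo a u) (*-homo b w))

    combination-homo : ∀ {n} (c : Fin n → ℂ) b → f (combination U c b) ≋ combination U c (f ∘ b)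
    combination-homo {zero}  c b = 0-homo ≋-refl
    combination-homo {suc n} c b = ≋-trans (⊕-homo (c zero *ₗ b zero) _)
      (⊕-cong (*-homo (c zero) (b zero)) (combination-homo (c ∘ suc) (b ∘ suc)))

  open Linear public

  ⊕-linear : ∀ {f g} → Linear f → Linear g → Linear (λ u → f u ⊕ g u)
  ⊕-linear f g = record
    { f-cong = λ p → ⊕-cong (f-cong f p) (f-cong g p)
    ; ⊕-homo = λ u w → ≋-trans (⊕-cong (⊕-homo f u w) (⊕-homo g u w))
        (pointwise λ y → solve 4 (λ fu fw gu gw → (fu :+ fw) :+ (gu :+ gw) := (fu :+ gu) :+ (fw :+ gw))
          C.refl _ _ _ _)
    ; *-homo = λ c u → ≋-trans (⊕-cong (*-homo f c u) (*-homo g c u))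
        (pointwise λ y → C.sym (C.distribˡ c _ _))
    }

  *ₗ-linear : ∀ {f} a → Linear f → Linear (λ u → a *ₗ f u)
  *ₗ-linear a f = record
    { f-cong = λ p → *ₗ-cong C.refl (f-cong f p)
    ; ⊕-homo = λ u w → ≋-trans (*ₗ-cong C.refl (⊕-homo f u w)) (pointwise λ y → C.distribˡ a _ _)
    ; *-homo = λ c u → ≋-trans (*ₗ-cong C.refl (*-homo f c u))
        (pointwise λ y → solve 3 (λ a c fu → a :* (c :* fu) := c :* (a :* fu)) C.refl _ _ _)
    }

  id-linear : Linear (λ u → u)
  id-linear = record { f-cong = λ p → p ; ⊕-homo = λ _ _ → ≋-refl ; *-homo = λ _ _ → ≋-refl }

  ∘-linear : ∀ {f g} → Linear f → Linear g → Linear (f ∘ g)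
  ∘-linear f g = record
    { f-cong = λ p → f-cong f (f-cong g p)
    ; ⊕-homo = λ u w → ≋-trans (f-cong f (⊕-homo g u w)) (⊕-homo f _ _)
    ; *-homo = λ c u → ≋-trans (f-cong f (*-homo g c u)) (*-homo f c _)
    }

  pow-linear : ∀ {f} → Linear f → ∀ n → Linear (pow f n)
  pow-linear F zero    = id-linear
  pow-linear F (suc n) = ∘-linear (pow-linear F n) F

  linear-operator : (L : LinearOperator U) → Linear (LinearOperator.apply L)
  linear-operator L = record
    { f-cong = λ p → pointwise (⟦⟧-cong (at p))
    ; ⊕-homo = λ u w → pointwise (+ᴹ-homo u w)
    ; *-homo = λ c u → pointwise (*ₗ-homo c u)
    }
    where
    open LinearOperator L
    open LeftModuleMorphisms.IsLeftModuleHomomorphism isLinear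

  combination-cong : ∀ {n} {c c′ : Fin n → ℂ} {b b′ : Fin n → Carrierᴹ} →
    (∀ i → c i ≈ c′ i) → (∀ i → b i ≋ b′ i) → combination U c b ≋ combination U c′ b′
  combination-cong {zero}  p q = ≋-refl
  combination-cong {suc n} p q = ⊕-cong (*ₗ-cong (p zero) (q zero)) (combination-cong (p ∘ suc) (q ∘ suc))

  combination-lincomb : ∀ {n} α (c : Fin n → ℂ) β c′ b →
    combination U (λ i → α * c i + β * c′ i) b ≋ α *ₗ combination U c b ⊕ β *ₗ combination U c′ b
  combination-lincomb {zero}  α c β c′ b = ≋-sym (⊕-zero (*ₗ-zeroʳ α) (*ₗ-zeroʳ β))
  combination-lincomb {suc n} α c β c′ b = ≋-trans
    (⊕-cong ≋-refl (combination-lincomb α (c ∘ suc) β (c′ ∘ suc) (b ∘ suc)))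
    (pointwise λ y → solve 7 (λ α x β x′ b s s′ →
      (α :* x :+ β :* x′) :* b :+ (α :* s :+ β :* s′) := α :* (x :* b :+ s) :+ β :* (x′ :* b :+ s′))
      C.refl _ _ _ _ _ _ _)

  combination-zero : ∀ {n} {c : Fin n → ℂ} {b : Fin n → Carrierᴹ} →
    (∀ i → c i *ₗ b i ≋ 0ᵁ) → combination U c b ≋ 0ᵁ
  combination-zero {zero}  p = ≋-refl
  combination-zero {suc n} p = ⊕-zero (p zero) (combination-zero (p ∘ suc))

  -- When `m` is out of range the left side is zero, and the hypothesis makes the right side zero
  -- too. Thus the image of the last basis vector under F needs no separate case.
  combination-single : ∀ n (v : ℕ → Carrierᴹ) m s → (n ℕ.≤ m → v m ≋ 0ᵁ) →
    combination U {n} (λ i → if toℕ i ℕ.≡ᵇ m then s else 0#) (v ∘ toℕ) ≋ s *ₗ v m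
  combination-single zero    v m       s vm≈0 = ≋-sym (≋-trans (*ₗ-cong C.refl (vm≈0 z≤n)) (*ₗ-zeroʳ s))
  combination-single (suc n) v zero    s vm≈0 = ≋-trans
    (⊕-cong ≋-refl (combination-zero {n} {b = v ∘ suc ∘ toℕ} λ i → *ₗ-zeroˡ (v (suc (toℕ i)))))
    (pointwise λ y → C.+-identityʳ _)
  combination-single (suc n) v (suc m) s vm≈0 = ≋-trans
    (⊕-cong (*ₗ-zeroˡ (v 0)) (combination-single n (v ∘ suc) m s (vm≈0 ∘ s≤s)))
    (pointwise λ y → C.+-identityˡ _)

  Spans : ∀ {n} → (Fin n → Carrierᴹ) → Carrierᴹ → Set
  Spans b u = ∃[ c ] (u ≋ combination U c b)

  spans-lincomb : ∀ {n} {b : Fin n → Carrierᴹ} α {u} β {w} → Spans b u → Spans b w → Spans b (α *ₗ u ⊕ β *ₗ w)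
  spans-lincomb {b = b} α β (c , p) (c′ , q) = (λ i → α * c i + β * c′ i) ,
    ≋-trans (⊕-cong (*ₗ-cong C.refl p) (*ₗ-cong C.refl q)) (≋-sym (combination-lincomb α c β c′ b))

  spans-resp : ∀ {n} {b : Fin n → Carrierᴹ} {u w} → u ≋ w → Spans b u → Spans b w
  spans-resp p (c , q) = c , ≋-trans (≋-sym p) q

  spans-0 : ∀ {n} {b : Fin n → Carrierᴹ} → Spans b 0ᵁ
  spans-0 {b = b} = (λ _ → 0#) , ≋-sym (combination-zero λ i → *ₗ-zeroˡ (b i))

  ⊕-as-lincomb : ∀ u w → 1c *ₗ u ⊕ 1c *ₗ w ≋ u ⊕ w
  ⊕-as-lincomb u w = pointwise λ y → solve 2 (λ u w → con 1ᵍ :* u :+ con 1ᵍ :* w := u :+ w) C.refl _ _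

  *ₗ-as-lincomb : ∀ c u → c *ₗ u ⊕ 0# *ₗ u ≋ c *ₗ u
  *ₗ-as-lincomb c u = pointwise λ y → C.trans (C.+-congˡ (C.zeroˡ _)) (C.+-identityʳ _)

  spans-combination : ∀ {m n} {b : Fin n → Carrierᴹ} (c : Fin m → ℂ) (w : Fin m → Carrierᴹ) →
    (∀ i → Spans b (w i)) → Spans b (combination U c w)
  spans-combination {zero}  c w p = spans-0
  spans-combination {suc m} c w p = spans-resp
    (⊕-cong ≋-refl (pointwise λ y → 1c*z≈z _))
    (spans-lincomb (c zero) 1c (p zero) (spans-combination (c ∘ suc) (w ∘ suc) (p ∘ suc)))

  first-vanishing : ∀ f n u → ¬ u ≋ 0ᵁ → pow f n u ≋ 0ᵁ →
    ∃[ d ] (¬ pow f d u ≋ 0ᵁ × pow f (suc d) u ≋ 0ᵁ)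
  first-vanishing f zero    u u≉0 fⁿu≈0 = ⊥-elim (u≉0 fⁿu≈0)
  first-vanishing f (suc n) u u≉0 fⁿu≈0 with em {pow f n u ≋ 0ᵁ}
  ... | yes p = first-vanishing f n u u≉0 p
  ... | no ¬p = n , ¬p , fⁿu≈0

-- sl₂-triples and highest weight vectors

x-y≈0⇒x≈y : ∀ x y → x - y ≈ 0# → x ≈ y
x-y≈0⇒x≈y = CP.x∙y⁻¹≈ε⇒x≈y

≡ᵇ-true : ∀ {A : Set} {m n} {x y : A} → m ≡ n → (if m ℕ.≡ᵇ n then x else y) ≡ x
≡ᵇ-true {m = m} {n} m≡n with m ℕ.≡ᵇ n | ℕ.≡⇒≡ᵇ m n m≡n
... | true | _ = refl

≡ᵇ-false : ∀ {A : Set} {m n} {x y : A} → m ≢ n → (if m ℕ.≡ᵇ n then x else y) ≡ y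
≡ᵇ-false {m = m} {n} m≢n with m ℕ.≡ᵇ n | ℕ.≡ᵇ⇒≡ m n
... | true  | f = ⊥-elim (m≢n (f _))
... | false | _ = refl

module SL₂ (em : ExcludedMiddle 0ℓ) {X : Set} (W : Pred (X → ℂ) 0ℓ) (isSubspace : IsSubspace W) where

  open Representation em W isSubspace

  record SL₂Triple (E F H : Carrierᴹ → Carrierᴹ) : Set where
    field
      E-linear : Linear E
      F-linear : Linear F
      H-linear : Linear H
      HE-comm  : ∀ u → H (E u) ≋ E (H u) ⊕ 2c *ₗ E u
      HF-comm  : ∀ u → H (F u) ≋ F (H u) ⊕ - 2c *ₗ F u
      EF-comm  : ∀ u → E (F u) ≋ F (E u) ⊕ H u

  -- That `v` is nonzero is contained in `Fᵈv≉0`, because a power of a linear `F` sends zero to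
  -- zero.
  record HighestWeight (E F H : Carrierᴹ → Carrierᴹ) (d : ℕ) : Set where
    field
      v       : Carrierᴹ
      Fᵈv≉0   : ¬ pow F d v ≋ 0ᵁ
      Fᵈ⁺¹v≈0 : pow F (suc d) v ≋ 0ᵁ
      Ev≈0    : E v ≋ 0ᵁ
      Hv≈dv   : H v ≋ nat d *ₗ v

  module SL₂Properties {E F H : Carrierᴹ → Carrierᴹ} (triple : SL₂Triple E F H) where
    open SL₂Triple triple
    open SetoidReasoning ≋-setoid

    -- Passing each `F` costs -2. The correction is kept inside `pow F n`, so that it can be merged
    -- with other arguments of the same power.
    H-pow-F : ∀ n u → H (pow F n u) ≋ pow F n (H u ⊕ - (nat n + nat n) *ₗ u)
    H-pow-F zero    u = pointwise λ y →
      solve 2 (λ h u → h := h :+ :- (con 0ᵍ :+ con 0ᵍ) :* u) C.refl _ _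
    H-pow-F (suc n) u = begin
      H (pow F n (F u))                                    ≈⟨ H-pow-F n (F u) ⟩
      pow F n (H (F u) ⊕ - (nat n + nat n) *ₗ F u)         ≈⟨ f-cong Fⁿ shift ⟩
      pow F n (F (H u ⊕ - (nat (suc n) + nat (suc n)) *ₗ u)) ∎
      where
      Fⁿ = pow-linear F-linear n
      c = - (nat (suc n) + nat (suc n))
      shift : H (F u) ⊕ - (nat n + nat n) *ₗ F u ≋ F (H u ⊕ c *ₗ u)
      shift = begin
        H (F u) ⊕ - (nat n + nat n) *ₗ F u ≈⟨ ⊕-cong (HF-comm u) ≋-refl ⟩
        (F (H u) ⊕ - 2c *ₗ F u) ⊕ - (nat n + nat n) *ₗ F u
          -- The difference of the two sides is 2 F u times the difference of the sides of
          -- `nat-suc n`. All multipliers given to `using-equation` are found in this way.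
          ≈⟨ (pointwise λ y → using-equation (proj₁ (F u) y + proj₁ (F u) y) (nat-suc n)
               (solve 4 (λ n n⁺ f h →
                 h :+ :- con 2ᵍ :* f :+ :- (n :+ n) :* f :+ (f :+ f) :* (con 1ᵍ :+ n) :=
                 h :+ :- (n⁺ :+ n⁺) :* f :+ (f :+ f) :* n⁺)
                 C.refl _ _ _ _)) ⟩
        F (H u) ⊕ c *ₗ F u                 ≈⟨ ⊕-cong ≋-refl (*-homo F-linear c u) ⟨
        F (H u) ⊕ F (c *ₗ u)               ≈⟨ ⊕-homo F-linear (H u) (c *ₗ u) ⟨
        F (H u ⊕ c *ₗ u)                   ∎

    -- Commuting `E` past one `F` leaves an `H`, and the induction step is the identity (n+1)(H - n)
    -- + (H - 2(n+1)) = (n+2)(H - (n+1)).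
    EF-pow : ∀ {u} → E u ≋ 0ᵁ → ∀ n →
      E (pow F (suc n) u) ≋ pow F n (nat (suc n) *ₗ (H u ⊕ - nat n *ₗ u))
    EF-pow {u} Eu≈0 zero = begin
      E (F u)                             ≈⟨ EF-comm u ⟩
      F (E u) ⊕ H u                       ≈⟨ ⊕-cong (0-homo F-linear Eu≈0) ≋-refl ⟩
      0ᵁ ⊕ H u                            ≈⟨ (pointwise λ y → C.trans (C.+-identityˡ _) (C.trans
        (solve 2 (λ h u → h := (con 1ᵍ :+ con 0ᵍ) :* (h :+ :- con 0ᵍ :* u)) C.refl _ _)
        (C.*-congʳ (C.sym (nat-suc 0))))) ⟩
      nat 1 *ₗ (H u ⊕ - nat 0 *ₗ u)       ∎
    EF-pow {u} Eu≈0 (suc n) = begin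
      E (pow F (suc (suc n)) u)
        ≡⟨ cong E (pow-suc F (suc n) u) ⟩
      E (F (pow F (suc n) u))
        ≈⟨ EF-comm (pow F (suc n) u) ⟩
      F (E (pow F (suc n) u)) ⊕ H (pow F (suc n) u)
        ≈⟨ ⊕-cong (f-cong F-linear (EF-pow Eu≈0 n)) (H-pow-F (suc n) u) ⟩
      F (pow F n s) ⊕ pow F (suc n) t
        ≡⟨ cong (_⊕ pow F (suc n) t) (pow-suc F n s) ⟨
      pow F (suc n) s ⊕ pow F (suc n) t
        ≈⟨ ⊕-homo Fⁿ⁺¹ s t ⟨
      pow F (suc n) (s ⊕ t)
        ≈⟨ f-cong Fⁿ⁺¹ (pointwise λ y →
             using-equation (proj₁ (H u) y + - nat (suc n) * proj₁ u y) (C.sym (nat-suc (suc n)))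
             (using-equation (- (nat (suc n) * proj₁ u y)) (C.sym (nat-suc n))
             (solve 5 (λ n n⁺ n⁺⁺ h u → 
                n⁺ :* (h :+ :- n :* u) :+ (h :+ :- (n⁺ :+ n⁺) :* u)
                  :+ (h :+ :- n⁺ :* u) :* n⁺⁺ :+ :- (n⁺ :* u) :* n⁺ :=
                n⁺⁺ :* (h :+ :- n⁺ :* u)
                  :+ (h :+ :- n⁺ :* u) :* (con 1ᵍ :+ n⁺) :+ :- (n⁺ :* u) :* (con 1ᵍ :+ n))
                C.refl _ _ _ _ _))) ⟩
      pow F (suc n) (nat (suc (suc n)) *ₗ (H u ⊕ - nat (suc n) *ₗ u)) ∎
      where
      Fⁿ⁺¹ = pow-linear F-linear (suc n)
      s = nat (suc n) *ₗ (H u ⊕ - nat n *ₗ u)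
      t = H u ⊕ - (nat (suc n) + nat (suc n)) *ₗ u

    -- The factors H - n are applied singly, in decreasing order of n, until one kills the current
    -- vector, which is then an eigenvector. If none did, the recursion would end in a nonzero `u`
    -- with `u ≋ 0ᵁ`.
    eigenvector : ∀ n u → ¬ u ≋ 0ᵁ → E u ≋ 0ᵁ → pow E n (pow F n u) ≋ 0ᵁ →
      ∃[ m ] ∃[ v ] (¬ v ≋ 0ᵁ × E v ≋ 0ᵁ × H v ≋ nat m *ₗ v)
    eigenvector zero    u u≉0 Eu≈0 u≈0 = ⊥-elim (u≉0 u≈0)
    eigenvector (suc n) u u≉0 Eu≈0 EFu≈0 with em {H u ⊕ - nat n *ₗ u ≋ 0ᵁ}
    ... | yes Hu-nu≈0 = n , u , u≉0 , Eu≈0 , pointwise λ y →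
      using-equation 1c (at Hu-nu≈0 y) (C.trans (C.+-congˡ (C.zeroʳ 1c))
        (C.trans (C.+-identityʳ _)
        (solve 3 (λ h n u → h := n :* u :+ con 1ᵍ :* (h :+ :- n :* u)) C.refl _ _ _)))
    ... | no  u′≉0    = eigenvector n u′ u′≉0 Eu′≈0 EFu′≈0
      where
      u′ = H u ⊕ - nat n *ₗ u
      Eu′≈0 : E u′ ≋ 0ᵁ
      Eu′≈0 = begin
        E u′                              ≈⟨ ⊕-homo E-linear (H u) _ ⟩
        E (H u) ⊕ E (- nat n *ₗ u)        ≈⟨ ⊕-cong EHu≈0
          (≋-trans (*-homo E-linear _ u) (≋-trans (*ₗ-cong C.refl Eu≈0) (*ₗ-zeroʳ _))) ⟩
        0ᵁ ⊕ 0ᵁ                           ≈⟨ ⊕-zero ≋-refl ≋-refl ⟩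
        0ᵁ                                ∎
        where
        EHu≈0 : E (H u) ≋ 0ᵁ
        EHu≈0 = begin
          E (H u)                 ≈⟨ (pointwise λ y → C.sym (C.trans
            (C.+-congˡ (C.trans (C.*-congˡ (at Eu≈0 y)) (C.zeroʳ 2c))) (C.+-identityʳ _))) ⟩
          E (H u) ⊕ 2c *ₗ E u     ≈⟨ HE-comm u ⟨
          H (E u)                 ≈⟨ 0-homo H-linear Eu≈0 ⟩
          0ᵁ                      ∎
      Eⁿ = pow-linear E-linear n
      Fⁿ = pow-linear F-linear n
      -- `EF-pow` gives only (n+1) EⁿFⁿu′ ≈ 0; characteristic zero removes the factor n+1.
      EFu′≈0 : pow E n (pow F n u′) ≋ 0ᵁ
      EFu′≈0 with em {pow E n (pow F n u′) ≋ 0ᵁ}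
      ... | yes p = p
      ... | no ¬p = ⊥-elim (nat-suc≉0 n (*ₗ-torsionFree ¬p (begin
        nat (suc n) *ₗ pow E n (pow F n u′)      ≈⟨ *-homo Eⁿ _ _ ⟨
        pow E n (nat (suc n) *ₗ pow F n u′)      ≈⟨ f-cong Eⁿ (*-homo Fⁿ _ u′) ⟨
        pow E n (pow F n (nat (suc n) *ₗ u′))    ≈⟨ f-cong Eⁿ (EF-pow Eu≈0 n) ⟨
        pow E n (E (pow F (suc n) u))            ≈⟨ EFu≈0 ⟩
        0ᵁ                                       ∎)))

    EF-pow-eigenvector : ∀ {c v} → E v ≋ 0ᵁ → H v ≋ c *ₗ v → ∀ n →
      E (pow F (suc n) v) ≋ (nat (suc n) * (c - nat n)) *ₗ pow F n v
    EF-pow-eigenvector {c} {v} Ev≈0 Hv≈cv n = begin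
      E (pow F (suc n) v)                             ≈⟨ EF-pow Ev≈0 n ⟩
      pow F n (nat (suc n) *ₗ (H v ⊕ - nat n *ₗ v))   ≈⟨ f-cong Fⁿ collect ⟩
      pow F n ((nat (suc n) * (c - nat n)) *ₗ v)      ≈⟨ *-homo Fⁿ _ v ⟩
      (nat (suc n) * (c - nat n)) *ₗ pow F n v        ∎
      where
      Fⁿ = pow-linear F-linear n
      collect : nat (suc n) *ₗ (H v ⊕ - nat n *ₗ v) ≋ (nat (suc n) * (c - nat n)) *ₗ v
      collect = pointwise λ y → using-equation (nat (suc n)) (at Hv≈cv y)
        (solve 5 (λ n⁺ n c h v → n⁺ :* (h :+ :- n :* v) :+ n⁺ :* (c :* v) :=
          n⁺ :* (c :- n) :* v :+ n⁺ :* h) C.refl _ _ _ _ _)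

    -- Applying `E` to Fᵈ⁺¹v ≈ 0 yields (d+1)(m - d) Fᵈv ≈ 0.
    eigenvalue≡length : ∀ d m {v} → E v ≋ 0ᵁ → H v ≋ nat m *ₗ v →
      ¬ pow F d v ≋ 0ᵁ → pow F (suc d) v ≋ 0ᵁ → m ≡ d
    eigenvalue≡length d m {v} Ev≈0 Hv≈mv Fᵈv≉0 Fᵈ⁺¹v≈0 =
      [ (λ d⁺≈0 → ⊥-elim (nat-suc≉0 d d⁺≈0)) , (λ m-d≈0 → nat-injective (x-y≈0⇒x≈y (nat m) (nat d) m-d≈0)) ]′
      (ℂ-noZeroDivisors em (nat (suc d)) (nat m - nat d)
        (*ₗ-torsionFree Fᵈv≉0 (≋-trans (≋-sym (EF-pow-eigenvector Ev≈0 Hv≈mv d)) (0-homo E-linear Fᵈ⁺¹v≈0))))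

    highest-weight : ∀ n → (∀ u → pow E n u ≋ 0ᵁ) → (∀ u → pow F n u ≋ 0ᵁ) →
      ∀ {w} → ¬ w ≋ 0ᵁ → ∃[ d ] HighestWeight E F H d
    highest-weight n Eⁿ≈0 Fⁿ≈0 {w} w≉0 =
      -- The last nonzero power of `E` on `w` lies in ker E and starts the search.
      let e , Eᵉw≉0 , Eᵉ⁺¹w≈0 = first-vanishing E n w w≉0 (Eⁿ≈0 w)
          EEᵉw≈0 = ≋-trans (≋-reflexive (≡.sym (pow-suc E e w))) Eᵉ⁺¹w≈0
          m , v , v≉0 , Ev≈0 , Hv≈mv = eigenvector n (pow E e w) Eᵉw≉0 EEᵉw≈0 (Eⁿ≈0 _)
          d , Fᵈv≉0 , Fᵈ⁺¹v≈0 = first-vanishing F n v v≉0 (Fⁿ≈0 v)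
          m≡d = eigenvalue≡length d m Ev≈0 Hv≈mv Fᵈv≉0 Fᵈ⁺¹v≈0
      in d , record
        { v = v ; Fᵈv≉0 = Fᵈv≉0 ; Fᵈ⁺¹v≈0 = Fᵈ⁺¹v≈0 ; Ev≈0 = Ev≈0
        ; Hv≈dv = subst (λ k → H v ≋ nat k *ₗ v) m≡d Hv≈mv }

    module Basis {d : ℕ} (hw : HighestWeight E F H d) where
      open HighestWeight hw

      b : Fin (suc d) → Carrierᴹ
      b i = pow F (toℕ i) v

      beyond : ∀ {j} → suc d ℕ.≤ j → pow F j v ≋ 0ᵁ
      beyond {j} d<j = begin
        pow F j v                               ≡⟨ cong (λ k → pow F k v) (ℕ.m∸n+n≡m d<j) ⟨
        pow F (j ℕ.∸ suc d ℕ.+ suc d) v         ≡⟨ pow-+ (j ℕ.∸ suc d) ⟩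
        pow F (j ℕ.∸ suc d) (pow F (suc d) v)   ≈⟨ 0-homo (pow-linear F-linear (j ℕ.∸ suc d)) Fᵈ⁺¹v≈0 ⟩
        0ᵁ                                      ∎
        where
        pow-+ : ∀ m → pow F (m ℕ.+ suc d) v ≡ pow F m (pow F (suc d) v)
        pow-+ zero    = refl
        pow-+ (suc m) = ≡.trans (pow-suc F (m ℕ.+ suc d) v)
          (≡.trans (cong F (pow-+ m)) (≡.sym (pow-suc F m _)))

      weight : ℕ → ℂ
      weight j = nat d - (nat j + nat j)

      -- The coefficient of Fʲ⁻¹v in E Fʲv. Truncation of `ℕ.pred` at 0 does no harm: column 0 of
      -- `upper` is zero, as no row satisfies `suc (toℕ i) ≡ 0`.
      rise : ℕ → ℂ
      rise j = nat j * (nat d - nat (ℕ.pred j))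

      diagonal lower upper : Fin (suc d) → Fin (suc d) → ℂ
      diagonal i j = if toℕ i ℕ.≡ᵇ toℕ j then weight (toℕ j) else 0#
      lower i j = if toℕ i ℕ.≡ᵇ suc (toℕ j) then 1# else 0#
      upper i j = if suc (toℕ i) ℕ.≡ᵇ toℕ j then rise (toℕ j) else 0#

      tridiagonal : ℂ → ℂ → Fin (suc d) → Fin (suc d) → ℂ
      tridiagonal α β i j = α * upper i j + β * lower i j

      H-matrix : ∀ j → H (b j) ≋ combination U (λ i → diagonal i j) b
      H-matrix j = begin
        H (pow F n v)                           ≈⟨ H-pow-F n v ⟩
        pow F n (H v ⊕ - (nat n + nat n) *ₗ v)  ≈⟨ f-cong Fⁿ collect ⟩
        pow F n (weight n *ₗ v)                 ≈⟨ *-homo Fⁿ _ v ⟩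
        weight n *ₗ pow F n v                   ≈⟨ combination-single (suc d) (λ k → pow F k v) n (weight n) beyond ⟨
        combination U (λ i → diagonal i j) b    ∎
        where
        n = toℕ j
        Fⁿ = pow-linear F-linear n
        collect : H v ⊕ - (nat n + nat n) *ₗ v ≋ weight n *ₗ v
        collect = pointwise λ y → using-equation 1c (at Hv≈dv y)
          (solve 4 (λ d n h v → (h :+ :- (n :+ n) :* v) :+ con 1ᵍ :* (d :* v) :=
            (d :- (n :+ n)) :* v :+ con 1ᵍ :* h) C.refl _ _ _ _)

      F-matrix : ∀ j → F (b j) ≋ combination U (λ i → lower i j) b
      F-matrix j = begin
        F (pow F (toℕ j) v)                     ≡⟨ pow-suc F (toℕ j) v ⟨
        pow F (suc (toℕ j)) v                   ≈⟨ (pointwise λ y → C.*-identityˡ _) ⟨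
        1# *ₗ pow F (suc (toℕ j)) v             ≈⟨ combination-single (suc d) (λ k → pow F k v) (suc (toℕ j)) 1# beyond ⟨
        combination U (λ i → lower i j) b       ∎

      E-matrix : ∀ j → E (b j) ≋ combination U (λ i → upper i j) b
      E-matrix zero    = ≋-trans Ev≈0 (≋-sym (combination-zero {b = b} λ i → *ₗ-zeroˡ (b i)))
      E-matrix (suc j) = ≋-trans (EF-pow-eigenvector Ev≈0 Hv≈dv (toℕ j)) (≋-sym
        (combination-single (suc d) (λ k → pow F k v) (toℕ j) (rise (suc (toℕ j))) beyond))

      tridiagonal-matrix : ∀ α β j → α *ₗ E (b j) ⊕ β *ₗ F (b j) ≋ combination U (λ i → tridiagonal α β i j) b
      tridiagonal-matrix α β j = ≋-trans
        (⊕-cong (*ₗ-cong C.refl (E-matrix j)) (*ₗ-cong C.refl (F-matrix j)))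
        (≋-sym (combination-lincomb α (λ i → upper i j) β (λ i → lower i j) b))

      diagonal-isDiagonal : IsDiagonal diagonal
      diagonal-isDiagonal i j i≢j = C.reflexive (≡ᵇ-false (i≢j ∘ Fin.toℕ-injective))

      tridiagonal-isIrreducible : ∀ {α β} → α ≉ 0# → β ≉ 0# → IsIrreducibleTridiagonal (tridiagonal α β)
      tridiagonal-isIrreducible {α} {β} α≉0 β≉0 = record
        { isTridiagonal = record { banded = banded }
        ; subdiagonal = λ i j i≡1+j entry≈0 → β≉0 (C.trans (C.sym (sub-entry i j i≡1+j)) entry≈0)
        ; superdiagonal = λ i j j≡1+i entry≈0 → rise≉0 i j j≡1+i
            ([ (λ α≈0 → ⊥-elim (α≉0 α≈0)) , (λ e → e) ]′
              (ℂ-noZeroDivisors em α (rise (toℕ j)) (C.trans (C.sym (super-entry i j j≡1+i)) entry≈0)))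
        }
        where
        entry : ∀ {x y i j} → upper i j ≈ x → lower i j ≈ y → tridiagonal α β i j ≈ α * x + β * y
        entry p q = C.+-cong (C.*-congˡ p) (C.*-congˡ q)

        α0+β0≈0 : α * 0# + β * 0# ≈ 0#
        α0+β0≈0 = C.trans (C.+-cong (C.zeroʳ α) (C.zeroʳ β)) (C.+-identityˡ 0#)

        banded : ∀ i j → tridiagonal α β i j ≉ 0# →
          toℕ i ≡ toℕ j ⊎ toℕ i ≡ suc (toℕ j) ⊎ toℕ j ≡ suc (toℕ i)
        banded i j entry≉0 with toℕ i ℕ.≟ suc (toℕ j) | toℕ j ℕ.≟ suc (toℕ i)
        ... | yes i≡1+j | _         = inj₂ (inj₁ i≡1+j)
        ... | no  _     | yes j≡1+i = inj₂ (inj₂ j≡1+i)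
        ... | no  i≢1+j | no  j≢1+i = ⊥-elim (entry≉0 (C.trans
          (entry {i = i} {j} (C.reflexive (≡ᵇ-false (j≢1+i ∘ ≡.sym))) (C.reflexive (≡ᵇ-false i≢1+j))) α0+β0≈0))

        sub-entry : ∀ i j → toℕ i ≡ suc (toℕ j) → tridiagonal α β i j ≈ β
        sub-entry i j i≡1+j = C.trans
          (entry {i = i} {j} (C.reflexive (≡ᵇ-false λ 1+i≡j → ℕ.m≢1+n+m (toℕ i) {1} (≡.trans i≡1+j (cong suc (≡.sym 1+i≡j)))))
            (C.reflexive (≡ᵇ-true i≡1+j)))
          (C.trans (C.+-cong (C.zeroʳ α) (C.*-identityʳ β)) (C.+-identityˡ β))

        super-entry : ∀ i j → toℕ j ≡ suc (toℕ i) → tridiagonal α β i j ≈ α * rise (toℕ j)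
        super-entry i j j≡1+i = C.trans
          (entry {i = i} {j} (C.reflexive (≡ᵇ-true (≡.sym j≡1+i)))
            (C.reflexive (≡ᵇ-false λ i≡1+j → ℕ.m≢1+n+m (toℕ i) {1} (≡.trans i≡1+j (cong suc j≡1+i)))))
          (C.trans (C.+-congˡ (C.zeroʳ β)) (C.+-identityʳ _))

        -- Both factors, j and d - (j - 1), are nonzero because 1 ≤ j ≤ d.
        rise≉0 : ∀ i j → toℕ j ≡ suc (toℕ i) → rise (toℕ j) ≉ 0#
        rise≉0 i j j≡1+i rise≈0 rewrite j≡1+i =
          [ nat-suc≉0 (toℕ i)
          , (λ d-i≈0 → ℕ.<-irrefl (≡.sym (nat-injective (x-y≈0⇒x≈y (nat d) (nat (toℕ i)) d-i≈0)))
              (ℕ.≤-pred (subst (ℕ._< suc d) j≡1+i (Fin.toℕ<n j)))) ]′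
          (ℂ-noZeroDivisors em (nat (suc (toℕ i))) (nat d - nat (toℕ i)) rise≈0)

      first-spanned : Spans b v
      first-spanned = (λ i → if toℕ i ℕ.≡ᵇ 0 then 1# else 0#) , ≋-sym (≋-trans
        (combination-single (suc d) (λ k → pow F k v) 0 1# λ ()) (pointwise λ y → C.*-identityˡ _))

      -- The power Fⁿ kills every term of a relation except the leading one, so the leading
      -- coefficient vanishes. What remains is a relation of the same kind, one term shorter, that
      -- starts at `F u`.
      independent : ∀ c → combination U c b ≋ 0ᵁ → ∀ i → c i ≈ 0#
      independent = powers-independent d v Fᵈv≉0 Fᵈ⁺¹v≈0
        where
        powers-independent : ∀ n u → ¬ pow F n u ≋ 0ᵁ → pow F (suc n) u ≋ 0ᵁ →
          ∀ (c : Fin (suc n) → ℂ) → combination U c (λ i → pow F (toℕ i) u) ≋ 0ᵁ → ∀ i → c i ≈ 0#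
        powers-independent n u Fⁿu≉0 Fⁿ⁺¹u≈0 c c≈0 = λ where
            zero    → c₀≈0
            (suc i) → rest n Fⁿu≉0 Fⁿ⁺¹u≈0 c tail≈0 i
          where
          Fⁿ = pow-linear F-linear n
          tail : Carrierᴹ
          tail = combination U (c ∘ suc) (λ i → pow F (suc (toℕ i)) u)
          Fⁿtail≈0 : pow F n tail ≋ 0ᵁ
          -- Powers of `F` commute, so Fⁿ Fⁱ⁺¹u = Fⁱ Fⁿ⁺¹u.
          Fⁿtail≈0 = ≋-trans (combination-homo Fⁿ (c ∘ suc) _) (combination-zero λ i → ≋-trans
            (*ₗ-cong C.refl (≋-trans (≋-reflexive (pow-comm F n (toℕ i) (F u)))
              (0-homo (pow-linear F-linear (toℕ i)) Fⁿ⁺¹u≈0)))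
            (*ₗ-zeroʳ (c (suc i))))
          c₀≈0 : c zero ≈ 0#
          c₀≈0 = *ₗ-torsionFree Fⁿu≉0 (begin
            c zero *ₗ pow F n u                      ≈⟨ (pointwise λ y → C.+-identityʳ _) ⟨
            c zero *ₗ pow F n u ⊕ 0ᵁ                 ≈⟨ ⊕-cong (*-homo Fⁿ (c zero) u) Fⁿtail≈0 ⟨
            pow F n (c zero *ₗ u) ⊕ pow F n tail     ≈⟨ ⊕-homo Fⁿ (c zero *ₗ u) tail ⟨
            pow F n (c zero *ₗ u ⊕ tail)             ≈⟨ 0-homo Fⁿ c≈0 ⟩
            0ᵁ                                       ∎)
          tail≈0 : tail ≋ 0ᵁ
          tail≈0 = begin
            tail                    ≈⟨ (pointwise λ y → C.+-identityˡ _) ⟨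
            0ᵁ ⊕ tail               ≈⟨ ⊕-cong (≋-trans (*ₗ-cong c₀≈0 ≋-refl) (*ₗ-zeroˡ u)) ≋-refl ⟨
            c zero *ₗ u ⊕ tail      ≈⟨ c≈0 ⟩
            0ᵁ                      ∎
          rest : ∀ n → ¬ pow F n u ≋ 0ᵁ → pow F (suc n) u ≋ 0ᵁ → (c : Fin (suc n) → ℂ) →
            combination U (c ∘ suc) (λ i → pow F (suc (toℕ i)) u) ≋ 0ᵁ → ∀ i → c (suc i) ≈ 0#
          rest (suc n) p q c t = powers-independent n (F u) p q (c ∘ suc) t

-- Leonard triples

module LeonardTriples (em : ExcludedMiddle 0ℓ) {X : Set} (W : Pred (X → ℂ) 0ℓ) (isSubspace : IsSubspace W) where

  open Representation em W isSubspace
  open SL₂ em W isSubspace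

  -- `X`, `Y`, `H` stand for Lₖ₊₁, Lₖ₊₂, Lₖ, so that one computation serves all three `k`.
  module CyclicTriple {X Y H : Carrierᴹ → Carrierᴹ}
    (X-linear : Linear X) (Y-linear : Linear Y) (H-linear : Linear H)
    (XY-comm : ∀ u → X (Y u) ≋ Y (X u) ⊕ 2ic *ₗ H u)
    (YH-comm : ∀ u → Y (H u) ≋ H (Y u) ⊕ 2ic *ₗ X u)
    (HX-comm : ∀ u → H (X u) ≋ X (H u) ⊕ 2ic *ₗ Y u) where

    raise lower : Carrierᴹ → Carrierᴹ
    raise u = ½c *ₗ X u ⊕ ½ic *ₗ Y u
    lower u = ½c *ₗ X u ⊕ - ½ic *ₗ Y u

    raise-linear : Linear raise
    raise-linear = ⊕-linear (*ₗ-linear ½c X-linear) (*ₗ-linear ½ic Y-linear)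

    lower-linear : Linear lower
    lower-linear = ⊕-linear (*ₗ-linear ½c X-linear) (*ₗ-linear (- ½ic) Y-linear)

    sl₂Triple : SL₂Triple raise lower H
    sl₂Triple = record
      { E-linear = raise-linear
      ; F-linear = lower-linear
      ; H-linear = H-linear
      ; HE-comm = λ u → ≋-trans (lincomb H-linear ½c (X u) ½ic (Y u)) (pointwise λ y →
          -- The multipliers are the coefficients of `X` and `Y` in `raise`, the second with its
          -- sign reversed since `YH-comm` gives [Y, H] rather than [H, Y].
          using-equation ½c (at (HX-comm u) y) (using-equation (- ½ic) (at (YH-comm u) y)
          (solve 6 (λ x y xh yh hx hy →
            con ½ᵍ :* hx :+ con ½iᵍ :* hy
              :+ con ½ᵍ :* (xh :+ con 2iᵍ :* y) :+ :- con ½iᵍ :* (hy :+ con 2iᵍ :* x) :=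
            (con ½ᵍ :* xh :+ con ½iᵍ :* yh) :+ con 2ᵍ :* (con ½ᵍ :* x :+ con ½iᵍ :* y)
              :+ con ½ᵍ :* hx :+ :- con ½iᵍ :* yh)
            C.refl _ _ _ _ _ _)))
      ; HF-comm = λ u → ≋-trans (lincomb H-linear ½c (X u) (- ½ic) (Y u)) (pointwise λ y →
          using-equation ½c (at (HX-comm u) y) (using-equation ½ic (at (YH-comm u) y)
          (solve 6 (λ x y xh yh hx hy →
            con ½ᵍ :* hx :+ :- con ½iᵍ :* hy
              :+ con ½ᵍ :* (xh :+ con 2iᵍ :* y) :+ con ½iᵍ :* (hy :+ con 2iᵍ :* x) :=
            (con ½ᵍ :* xh :+ :- con ½iᵍ :* yh) :+ :- con 2ᵍ :* (con ½ᵍ :* x :+ :- con ½iᵍ :* y)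
              :+ con ½ᵍ :* hx :+ con ½iᵍ :* yh)
            C.refl _ _ _ _ _ _)))
      ; EF-comm = λ u → ≋-trans
          (⊕-cong (*ₗ-cong C.refl (lincomb X-linear ½c (X u) (- ½ic) (Y u)))
                  (*ₗ-cong C.refl (lincomb Y-linear ½c (X u) (- ½ic) (Y u))))
          (≋-trans
            -- [E, F] = ¼ [X + iY, X - iY] = -½ i [X, Y].
            (pointwise λ y → using-equation (- ½ic) (at (XY-comm u) y)
              (solve 5 (λ xx xy yx yy h →
                con ½ᵍ :* (con ½ᵍ :* xx :+ :- con ½iᵍ :* xy) :+ con ½iᵍ :* (con ½ᵍ :* yx :+ :- con ½iᵍ :* yy)
                  :+ :- con ½iᵍ :* (yx :+ con 2iᵍ :* h) :=
                (con ½ᵍ :* (con ½ᵍ :* xx :+ con ½iᵍ :* xy) :+ :- con ½iᵍ :* (con ½ᵍ :* yx :+ con ½iᵍ :* yy)) :+ h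
                  :+ :- con ½iᵍ :* xy)
                C.refl _ _ _ _ _))
            (≋-sym (⊕-cong
              (⊕-cong (*ₗ-cong C.refl (lincomb X-linear ½c (X u) ½ic (Y u)))
                      (*ₗ-cong C.refl (lincomb Y-linear ½c (X u) ½ic (Y u))))
              ≋-refl)))
      }

    X-tridiagonal : ∀ u → X u ≋ 1c *ₗ raise u ⊕ 1c *ₗ lower u
    X-tridiagonal u = pointwise λ y → solve 2 (λ x y → x :=
      con 1ᵍ :* (con ½ᵍ :* x :+ con ½iᵍ :* y) :+ con 1ᵍ :* (con ½ᵍ :* x :+ :- con ½iᵍ :* y))
      C.refl _ _

    Y-tridiagonal : ∀ u → Y u ≋ - ic *ₗ raise u ⊕ ic *ₗ lower u
    Y-tridiagonal u = pointwise λ y → solve 2 (λ x y → y :=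
      :- con iᵍ :* (con ½ᵍ :* x :+ con ½iᵍ :* y) :+ con iᵍ :* (con ½ᵍ :* x :+ :- con ½iᵍ :* y))
      C.refl _ _

    casimir : Carrierᴹ → Carrierᴹ
    casimir u = X (X u) ⊕ (Y (Y u) ⊕ H (H u))

    casimir-linear : Linear casimir
    casimir-linear = ⊕-linear (∘-linear X-linear X-linear)
      (⊕-linear (∘-linear Y-linear Y-linear) (∘-linear H-linear H-linear))

    -- [Y², X] = -2i (YH + HY) and [H², X] = 2i (HY + YH) cancel. Cyclic symmetry will carry this
    -- over to the other two operators.
    casimir-X : ∀ u → casimir (X u) ≋ X (casimir u)
    casimir-X u = ≋-sym (≋-trans
      (≋-trans (⊕-homo X-linear _ _) (⊕-cong ≋-refl (⊕-homo X-linear _ _)))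
      (pointwise λ y →
        using-equation 1c (at (XY-comm (Y u)) y)
        (using-equation 1c (at YXY y)
        (using-equation (- 1c) (at (HX-comm (H u)) y)
        (using-equation (- 1c) (at HHX y)
        (solve 9 (λ xxx xyy xhh yyx hhx yxy hxh hy yh →
          xxx :+ (xyy :+ xhh) :+ con 1ᵍ :* (yxy :+ con 2iᵍ :* hy) :+ con 1ᵍ :* (yyx :+ con 2iᵍ :* yh)
            :+ :- con 1ᵍ :* (xhh :+ con 2iᵍ :* yh) :+ :- con 1ᵍ :* (hxh :+ con 2iᵍ :* hy) :=
          xxx :+ (yyx :+ hhx) :+ con 1ᵍ :* xyy :+ con 1ᵍ :* yxy
            :+ :- con 1ᵍ :* hxh :+ :- con 1ᵍ :* hhx)
          C.refl _ _ _ _ _ _ _ _ _))))))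
      where
      YXY : Y (X (Y u)) ≋ Y (Y (X u)) ⊕ 2ic *ₗ Y (H u)
      YXY = ≋-trans (f-cong Y-linear (XY-comm u))
        (≋-trans (⊕-homo Y-linear _ _) (⊕-cong ≋-refl (*-homo Y-linear 2ic (H u))))
      HHX : H (H (X u)) ≋ H (X (H u)) ⊕ 2ic *ₗ H (Y u)
      HHX = ≋-trans (f-cong H-linear (HX-comm u))
        (≋-trans (⊕-homo H-linear _ _) (⊕-cong ≋-refl (*-homo H-linear 2ic (Y u))))

    -- X² + Y² + H² = 4FE + 2H + H², and FE kills `v`.
    casimir-highest : ∀ {c v} → raise v ≋ 0ᵁ → H v ≋ c *ₗ v →
      casimir v ≋ (c * c + (c + c)) *ₗ v
    casimir-highest {c} {v} Ev≈0 Hv≈cv = pointwise λ y →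
      -- Since 4F = 2X - 2iY, the equations X E v ≈ 0 and Y E v ≈ 0 enter with multipliers 2 and
      -- -2i. `G.0-homo` writes zero as the constant known to the solver.
      using-equation 2c (C.trans (at (XE≈0 X-linear) y) (C.sym G.0-homo))
      (using-equation (- 2ic) (C.trans (at (XE≈0 Y-linear) y) (C.sym G.0-homo))
      (using-equation (- ic) (at (XY-comm v) y)
      (using-equation 1c (at (≋-trans (f-cong H-linear Hv≈cv) (*-homo H-linear c v)) y)
      (using-equation (c + 2c) (at Hv≈cv y)
      (solve 8 (λ c xx xy yx yy hh h v →
        xx :+ (yy :+ hh) :+ con 2ᵍ :* con 0ᵍ :+ :- con 2iᵍ :* con 0ᵍ
          :+ :- con iᵍ :* (yx :+ con 2iᵍ :* h) :+ con 1ᵍ :* (c :* h) :+ (c :+ con 2ᵍ) :* (c :* v) :=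
        (c :* c :+ (c :+ c)) :* v :+ con 2ᵍ :* (con ½ᵍ :* xx :+ con ½iᵍ :* xy)
          :+ :- con 2iᵍ :* (con ½ᵍ :* yx :+ con ½iᵍ :* yy)
          :+ :- con iᵍ :* xy :+ con 1ᵍ :* hh :+ (c :+ con 2ᵍ) :* h)
        C.refl _ _ _ _ _ _ _ _)))))
      where
      XE≈0 : ∀ {Z} → Linear Z → ½c *ₗ Z (X v) ⊕ ½ic *ₗ Z (Y v) ≋ 0ᵁ
      XE≈0 Z-linear = ≋-trans (≋-sym (lincomb Z-linear ½c (X v) ½ic (Y v))) (0-homo Z-linear Ev≈0)

  IsCyclic : (Fin 3 → LinearOperator U) → Set
  IsCyclic op = ∀ k u → L (next k) (L (next (next k)) u) ≋ L (next (next k)) (L (next k) u) ⊕ 2ic *ₗ L k u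
    where
    L : Fin 3 → Carrierᴹ → Carrierᴹ
    L k = LinearOperator.apply (op k)

  module Operators (op : Fin 3 → LinearOperator U) (commutator : IsCyclic op) where

    L : Fin 3 → Carrierᴹ → Carrierᴹ
    L k = LinearOperator.apply (op k)

    -- Instantiated twice: with the eigenspace of `Ω`, and with the span of a chain of weight
    -- vectors.
    record IsSubmodule (P : Carrierᴹ → Set) : Set where
      field
        P-resp    : ∀ {u w} → u ≋ w → P u → P w
        P-lincomb : ∀ a {u} b {w} → P u → P w → P (a *ₗ u ⊕ b *ₗ w)
        P-op      : ∀ k {u} → P u → P (L k u)

    L-linear : ∀ k → Linear (L k)
    L-linear k = linear-operator (op k)

    next³ : ∀ k → next (next (next k)) ≡ k
    next³ zero             = refl
    next³ (suc zero)       = refl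
    next³ (suc (suc zero)) = refl

    YH-comm : ∀ k u → L (next (next k)) (L k u) ≋ L k (L (next (next k)) u) ⊕ 2ic *ₗ L (next k) u
    YH-comm k u with commutator (next k) u
    ... | e rewrite next³ k = e

    HX-comm : ∀ k u → L k (L (next k) u) ≋ L (next k) (L k u) ⊕ 2ic *ₗ L (next (next k)) u
    HX-comm k u with commutator (next (next k)) u
    ... | e rewrite next³ k = e

    module Cyclic (k : Fin 3) = CyclicTriple (L-linear (next k)) (L-linear (next (next k))) (L-linear k)
      (commutator k) (YH-comm k) (HX-comm k)
    open Cyclic using (raise; lower)

    -- At this index the squares appear in the order L₀² + L₁² + L₂²; the other two Casimir
    -- operators are cyclic rearrangements of it.
    Ω : Carrierᴹ → Carrierᴹ
    Ω = Cyclic.casimir (suc (suc zero))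

    casimir≋Ω : ∀ k u → Cyclic.casimir k u ≋ Ω u
    casimir≋Ω zero             u = pointwise λ y → solve 3 (λ a b c → b :+ (c :+ a) := a :+ (b :+ c)) C.refl _ _ _
    casimir≋Ω (suc zero)       u = pointwise λ y → solve 3 (λ a b c → c :+ (a :+ b) := a :+ (b :+ c)) C.refl _ _ _
    casimir≋Ω (suc (suc zero)) u = ≋-refl

    -- Each `k` is `next k′`, so that `L k` is the operator called `X` in the cyclic triple of `k′`.
    Ω-L : ∀ k u → Ω (L k u) ≋ L k (Ω u)
    Ω-L k u = subst (λ l → Ω (L l u) ≋ L l (Ω u)) (next³ k)
      (≋-trans (≋-sym (casimir≋Ω k′ _)) (≋-trans (Cyclic.casimir-X k′ u)
        (f-cong (L-linear (next k′)) (casimir≋Ω k′ u))))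
      where k′ = next (next k)

    Ω-linear : Linear Ω
    Ω-linear = Cyclic.casimir-linear (suc (suc zero))

    module Irreducible
      (irreducible : ∀ {P} → IsSubmodule P → ∀ {u} → P u → ¬ u ≋ 0ᵁ → ∀ w → P w)
      {w : Carrierᴹ} (w≉0 : ¬ w ≋ 0ᵁ) {N : ℕ}
      (raise-nilpotent : ∀ k u → pow (raise k) N u ≋ 0ᵁ)
      (lower-nilpotent : ∀ k u → pow (lower k) N u ≋ 0ᵁ) where

      module Triple (k : Fin 3) where
        open SL₂Properties (Cyclic.sl₂Triple k) public

      weight-of : ∀ k → ∃[ d ] HighestWeight (raise k) (lower k) (L k) d
      weight-of k = Triple.highest-weight k N (raise-nilpotent k) (lower-nilpotent k) w≉0

      κ : ℕ → ℂ
      κ d = nat d * nat d + (nat d + nat d)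

      HighestWeight⇒v≉0 : ∀ {k d} (hw : HighestWeight (raise k) (lower k) (L k) d) → ¬ HighestWeight.v hw ≋ 0ᵁ
      HighestWeight⇒v≉0 {k} {d} hw v≈0 = Fᵈv≉0 (0-homo (pow-linear (Cyclic.lower-linear k) d) v≈0)
        where open HighestWeight hw

      Ω-highest : ∀ k {d} (hw : HighestWeight (raise k) (lower k) (L k) d) →
        Ω (HighestWeight.v hw) ≋ κ d *ₗ HighestWeight.v hw
      Ω-highest k hw = ≋-trans (≋-sym (casimir≋Ω k v)) (Cyclic.casimir-highest k Ev≈0 Hv≈dv)
        where open HighestWeight hw

      -- Schur's lemma: as `Ω` commutes with the operators, its eigenspace for `κ d` is a submodule,
      -- and it contains the nonzero highest weight vector.
      Ω-scalar : ∀ {k d} → HighestWeight (raise k) (lower k) (L k) d → ∀ u → Ω u ≋ κ d *ₗ u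
      Ω-scalar {k} {d} hw = irreducible {P = λ u → Ω u ≋ κ d *ₗ u} (record
        { P-resp = λ p e → ≋-trans (f-cong Ω-linear (≋-sym p)) (≋-trans e (*ₗ-cong C.refl p))
        ; P-lincomb = λ a {u} b {w} p q → ≋-trans (lincomb Ω-linear a u b w)
            (≋-trans (⊕-cong (*ₗ-cong C.refl p) (*ₗ-cong C.refl q))
            (pointwise λ y → solve 5 (λ κ a u b w →
              a :* (κ :* u) :+ b :* (κ :* w) := κ :* (a :* u :+ b :* w)) C.refl _ _ _ _ _))
        ; P-op = λ l {u} e → ≋-trans (Ω-L l u)
            (≋-trans (f-cong (L-linear l) e) (*-homo (L-linear l) (κ d) u))
        }) (Ω-highest k hw) (HighestWeight⇒v≉0 hw)

      -- The difference factors as (d - e)(d + e + 2), and the second factor is a positive natural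
      -- number.
      κ-injective : ∀ d e → κ d ≈ κ e → d ≡ e
      κ-injective d e κd≈κe =
        [ (λ d-e≈0 → nat-injective (x-y≈0⇒x≈y (nat d) (nat e) d-e≈0))
        , (λ s≈0 → ⊥-elim (nat-suc≉0 (suc (d ℕ.+ e)) (C.trans (C.sym nat-sum) s≈0))) ]′
        (ℂ-noZeroDivisors em (nat d - nat e) (1c + (1c + (nat d + nat e)))
          (C.trans (solve 2 (λ d e → (d :- e) :* (con 1ᵍ :+ (con 1ᵍ :+ (d :+ e))) :=
              (d :* d :+ (d :+ d)) :- (e :* e :+ (e :+ e))) C.refl _ _)
            (C.trans (C.+-congʳ κd≈κe) (C.-‿inverseʳ (κ e)))))
        where
        nat-+ : ∀ m n → nat m + nat n ≈ nat (m ℕ.+ n)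
        nat-+ zero    n = C.trans (C.+-congʳ G.0-homo) (C.+-identityˡ (nat n))
        nat-+ (suc m) n = C.trans (C.+-congʳ (nat-suc m)) (C.trans (C.+-assoc _ _ _)
          (C.trans (C.+-congˡ (nat-+ m n)) (C.sym (nat-suc (m ℕ.+ n)))))
        nat-sum : 1c + (1c + (nat d + nat e)) ≈ nat (suc (suc (d ℕ.+ e)))
        nat-sum = C.trans (C.+-congˡ (C.trans (C.+-congˡ (nat-+ d e)) (C.sym (nat-suc (d ℕ.+ e)))))
          (C.sym (nat-suc (suc (d ℕ.+ e))))

      weights-equal : ∀ {k l d e} → HighestWeight (raise k) (lower k) (L k) d →
        HighestWeight (raise l) (lower l) (L l) e → d ≡ e
      weights-equal {k} {l} {d} {e} hw hw′ = κ-injective d e (x-y≈0⇒x≈y (κ d) (κ e)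
        (*ₗ-torsionFree {u = v} (HighestWeight⇒v≉0 hw) (pointwise λ y → C.trans (C.distribʳ (proj₁ v y) (κ d) (- κ e))
          (C.trans (C.+-cong (C.sym (at (Ω-scalar hw v) y)) (C.trans (C.sym (CP.-‿distribˡ-* (κ e) (proj₁ v y)))
            (C.-‿cong (C.sym (at (Ω-scalar hw′ v) y))))) (C.-‿inverseʳ _)))))
        where open HighestWeight hw

      LeonardBasis : ℕ → Fin 3 → Set
      LeonardBasis d k = Σ (Fin (suc d) → Carrierᴹ) λ b → IsBasis U b ×
        Σ (Fin 3 → Fin (suc d) → Fin (suc d) → ℂ) λ M →
          (∀ l → Represents U b (M l) (op l)) ×
          IsDiagonal (M k) ×
          (∀ l → l ≢ k → IsIrreducibleTridiagonal (M l))

      leonardBasis : ∀ {d} k → HighestWeight (raise k) (lower k) (L k) d → LeonardBasis d k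
      leonardBasis {d} k hw = b , isBasis , (λ l → entries (role k l)) ,
          (λ l j → at (entries-represent (role k l) j)) ,
          -- For a variable `k` the term `role k k` does not compute to `itself`.
          subst (IsDiagonal ∘ entries) (≡.sym (role-itself k)) diagonal-isDiagonal ,
          (λ l l≢k → entries-tridiagonal (role k l) l≢k)
        where
        open Triple.Basis k hw
        open HighestWeight hw

        entries : ∀ {l} → Role k l → Fin (suc d) → Fin (suc d) → ℂ
        entries itself = diagonal
        entries first  = tridiagonal 1c 1c
        entries second = tridiagonal (- ic) ic

        entries-represent : ∀ {l} (r : Role k l) j → L l (b j) ≋ combination U (λ i → entries r i j) b
        entries-represent itself j = H-matrix j
        entries-represent first  j = ≋-trans (Cyclic.X-tridiagonal k (b j)) (tridiagonal-matrix 1c 1c j)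
        entries-represent second j = ≋-trans (Cyclic.Y-tridiagonal k (b j)) (tridiagonal-matrix (- ic) ic j)

        entries-tridiagonal : ∀ {l} (r : Role k l) → l ≢ k → IsIrreducibleTridiagonal (entries r)
        entries-tridiagonal itself l≢k = ⊥-elim (l≢k refl)
        entries-tridiagonal first  _   = tridiagonal-isIrreducible (gaussian≉0 λ ()) (gaussian≉0 λ ())
        entries-tridiagonal second _   = tridiagonal-isIrreducible
          (λ -i≈0 → gaussian≉0 {𝔾.- iᵍ} (λ ()) (C.trans (G.-‿homo iᵍ) -i≈0)) (gaussian≉0 λ ())

        isBasis : IsBasis U b
        isBasis = record
          { independent = λ c c≈0 → independent c (pointwise c≈0)
          ; spanning = λ u → let c , e = spans u in c , at e
          }
          where
          spans : ∀ u → Spans b u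
          -- The matrix columns already found express every `L l (b j)` through `b`, so the span is
          -- invariant.
          spans = irreducible {P = Spans b} (record
            { P-resp = spans-resp {b = b}
            ; P-lincomb = λ α β → spans-lincomb {b = b} α β
            ; P-op = λ l (c , e) → spans-resp {b = b}
                (≋-sym (≋-trans (f-cong (L-linear l) e) (combination-homo (L-linear l) c b)))
                (spans-combination {b = b} c (L l ∘ b) λ j →
                  (λ i → entries (role k l) i j) , entries-represent (role k l) j)
            }) {v} first-spanned (HighestWeight⇒v≉0 hw)

      isLeonard : ∃[ d ] (∀ k → LeonardBasis d k)
      -- A Leonard triple demands one dimension for the three bases: `d` is read off at the first
      -- operator and the other weights are transported to it.
      isLeonard = let d , hw = weight-of zero in d , λ k →
        let e , hw′ = weight-of k in
        leonardBasis k (subst (HighestWeight (raise k) (lower k) (L k)) (weights-equal hw′ hw) hw′)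

-- The cube

Mat₂ : Set
Mat₂ = Bool → Bool → 𝔾

infixl 7 _⊙_
_⊙_ : Mat₂ → Mat₂ → Mat₂
(m ⊙ n) a c = m a false 𝔾.* n false c 𝔾.+ m a true 𝔾.* n true c

-- The matrix `m` on the first factor of V (suc D) = ℂ² ⊗ V D, with the index of that factor split
-- off as `a`.
act : ∀ {D} → Mat₂ → V (suc D) → Bool → V D
act m f a y = gaussian (m a false) * f (false ∷ y) + gaussian (m a true) * f (true ∷ y)

-- The Lie algebra action on a tensor power of ℂ², built up by 1 ⊗ Δ m + m ⊗ 1 from the empty sum at
-- D = 0.
Δ : Mat₂ → ∀ {D} → V D → V D
Δ m {zero}  f []      = gaussian 0ᵍ
Δ m {suc D} f (a ∷ y) = Δ m (λ z → f (a ∷ z)) y + act m f a y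

Δ-cong : ∀ m {D} {f g : V D} → (∀ y → f y ≈ g y) → ∀ y → Δ m f y ≈ Δ m g y
Δ-cong m {zero}  f≈g []      = C.refl
Δ-cong m {suc D} f≈g (a ∷ y) = C.+-cong (Δ-cong m (λ z → f≈g (a ∷ z)) y)
  (C.+-cong (C.*-congˡ (f≈g (false ∷ y))) (C.*-congˡ (f≈g (true ∷ y))))

Δ-lincomb : ∀ m {D} α (f : V D) β g y → Δ m (λ z → α * f z + β * g z) y ≈ α * Δ m f y + β * Δ m g y
Δ-lincomb m {zero}  α f β g []      = solve 2 (λ α β → con 0ᵍ := α :* con 0ᵍ :+ β :* con 0ᵍ) C.refl α β
Δ-lincomb m {suc D} α f β g (a ∷ y) = C.trans (C.+-congʳ (Δ-lincomb m α _ β _ y))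
  (solve 10 (λ α β x y sf sg f₀ f₁ g₀ g₁ →
    (α :* sf :+ β :* sg) :+ (x :* (α :* f₀ :+ β :* g₀) :+ y :* (α :* f₁ :+ β :* g₁)) :=
    α :* (sf :+ (x :* f₀ :+ y :* f₁)) :+ β :* (sg :+ (x :* g₀ :+ y :* g₁)))
    C.refl _ _ _ _ _ _ _ _ _ _)

Δ-+ : ∀ m {D} (f g : V D) y → Δ m (λ z → f z + g z) y ≈ Δ m f y + Δ m g y
Δ-+ m f g y = C.trans (Δ-cong m (λ z → C.sym (C.+-cong (1c*z≈z _) (1c*z≈z _))) y)
  (C.trans (Δ-lincomb m 1c f 1c g y) (C.+-cong (1c*z≈z _) (1c*z≈z _)))

Δ-matrix-lincomb : ∀ {m n n′ p q} → (∀ a b → m a b ≡ p 𝔾.* n a b 𝔾.+ q 𝔾.* n′ a b) →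
  ∀ {D} (f : V D) y → Δ m f y ≈ gaussian p * Δ n f y + gaussian q * Δ n′ f y
Δ-matrix-lincomb {p = p} {q} m≡ {zero}  f []      =
  solve 2 (λ p q → con 0ᵍ := p :* con 0ᵍ :+ q :* con 0ᵍ) C.refl (gaussian p) (gaussian q)
Δ-matrix-lincomb {m} {n} {n′} {p} {q} m≡ {suc D} f (a ∷ y) = C.trans
  (C.+-cong (Δ-matrix-lincomb m≡ (λ z → f (a ∷ z)) y)
    (C.+-cong (C.*-congʳ (entry false)) (C.*-congʳ (entry true))))
  (solve 10 (λ p q sn sn′ n₀ n₁ n₀′ n₁′ f₀ f₁ →
    (p :* sn :+ q :* sn′) :+ ((p :* n₀ :+ q :* n₀′) :* f₀ :+ (p :* n₁ :+ q :* n₁′) :* f₁) :=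
    p :* (sn :+ (n₀ :* f₀ :+ n₁ :* f₁)) :+ q :* (sn′ :+ (n₀′ :* f₀ :+ n₁′ :* f₁)))
    C.refl _ _ _ _ _ _ _ _ _ _)
  where
  entry : ∀ b → gaussian (m a b) ≈ gaussian p * gaussian (n a b) + gaussian q * gaussian (n′ a b)
  entry b = C.trans (C.reflexive (cong gaussian (m≡ a b)))
    (C.trans (G.+-homo _ _) (C.+-cong (G.*-homo _ _) (G.*-homo _ _)))

gaussian-⊙ : ∀ m n a c → gaussian ((m ⊙ n) a c) ≈
  gaussian (m a false) * gaussian (n false c) + gaussian (m a true) * gaussian (n true c)
gaussian-⊙ m n a c = C.trans (G.+-homo _ _) (C.+-cong (G.*-homo _ _) (G.*-homo _ _))

act-act : ∀ m n {D} (f : V (suc D)) a y →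
  gaussian (m a false) * act n f false y + gaussian (m a true) * act n f true y ≈ act (m ⊙ n) f a y
act-act m n f a y = C.trans
  (solve 8 (λ m₀ m₁ n₀₀ n₀₁ n₁₀ n₁₁ f₀ f₁ →
    m₀ :* (n₀₀ :* f₀ :+ n₀₁ :* f₁) :+ m₁ :* (n₁₀ :* f₀ :+ n₁₁ :* f₁) :=
    (m₀ :* n₀₀ :+ m₁ :* n₁₀) :* f₀ :+ (m₀ :* n₀₁ :+ m₁ :* n₁₁) :* f₁)
    C.refl _ _ _ _ _ _ _ _)
  (C.sym (C.+-cong (C.*-congʳ (gaussian-⊙ m n a false)) (C.*-congʳ (gaussian-⊙ m n a true))))

-- The four products are grouped as tail-tail, mixed and head-head. The mixed part n ⊗ Δ m + m ⊗ Δ n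
-- is symmetric in `m` and `n`, so it drops out of the commutator.
Δ-Δ : ∀ m n {D} (f : V (suc D)) a y → Δ m (Δ n f) (a ∷ y) ≈
  Δ m (Δ n (λ z → f (a ∷ z))) y + (act n (λ { (b ∷ z) → Δ m (λ z → f (b ∷ z)) z }) a y
    + act m (λ { (b ∷ z) → Δ n (λ z → f (b ∷ z)) z }) a y) + act (m ⊙ n) f a y
Δ-Δ m n f a y = C.trans
  (C.+-cong
    (C.trans (Δ-+ m _ (act n f a) y) (C.+-congˡ (Δ-lincomb m (gaussian (n a false)) _ (gaussian (n a true)) _ y)))
    (C.refl {x = act m (Δ n f) a y}))
  (C.trans
    (solve 8 (λ s t m₀ m₁ s₀ s₁ u₀ u₁ →
      (s :+ t) :+ (m₀ :* (s₀ :+ u₀) :+ m₁ :* (s₁ :+ u₁)) :=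
      s :+ (t :+ (m₀ :* s₀ :+ m₁ :* s₁)) :+ (m₀ :* u₀ :+ m₁ :* u₁))
      C.refl _ _ _ _ _ _ _ _)
    (C.+-congˡ (act-act m n f a y)))

Δ-commutator : ∀ {m n p} → (∀ a c → (m ⊙ n) a c ≡ (n ⊙ m) a c 𝔾.+ p a c) →
  ∀ {D} (f : V D) y → Δ m (Δ n f) y ≈ Δ n (Δ m f) y + Δ p f y
Δ-commutator comm {zero}  f []      = solve 0 (con 0ᵍ := con 0ᵍ :+ con 0ᵍ) C.refl
Δ-commutator {m} {n} {p} comm {suc D} f (a ∷ y) = C.trans (Δ-Δ m n f a y) (C.trans
  (C.+-cong (C.+-cong (Δ-commutator comm (λ z → f (a ∷ z)) y) (C.+-comm _ _))
    (C.+-cong (C.*-congʳ (entry false)) (C.*-congʳ (entry true))))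
  (C.trans
    (solve 9 (λ s t r x₀ x₁ p₀ p₁ f₀ f₁ →
      (s :+ t) :+ r :+ ((x₀ :+ p₀) :* f₀ :+ (x₁ :+ p₁) :* f₁) :=
      (s :+ r :+ (x₀ :* f₀ :+ x₁ :* f₁)) :+ (t :+ (p₀ :* f₀ :+ p₁ :* f₁)))
      C.refl _ _ _ _ _ _ _ _ _)
    (C.+-congʳ (C.sym (Δ-Δ n m f a y)))))
  where
  entry : ∀ c → gaussian ((m ⊙ n) a c) ≈ gaussian ((n ⊙ m) a c) + gaussian (p a c)
  entry c = C.trans (C.reflexive (cong gaussian (comm a c))) (G.+-homo _ _)

pow-Δ-cong : ∀ n k {D} {f g : V D} → (∀ y → f y ≈ g y) → ∀ y → pow (Δ n) k f y ≈ pow (Δ n) k g y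
pow-Δ-cong n zero    f≈g = f≈g
pow-Δ-cong n (suc k) f≈g = pow-Δ-cong n k (Δ-cong n f≈g)

pow-Δ-+ : ∀ n k {D} (f g : V D) y → pow (Δ n) k (λ z → f z + g z) y ≈ pow (Δ n) k f y + pow (Δ n) k g y
pow-Δ-+ n zero    f g y = C.refl
pow-Δ-+ n (suc k) f g y = C.trans (pow-Δ-cong n k (Δ-+ n f g) y) (pow-Δ-+ n k (Δ n f) (Δ n g) y)

module _ {n : Mat₂} (n²≡0 : ∀ a c → (n ⊙ n) a c ≡ 0ᵍ) where

  -- The head part of `Δ n` meets a second `n` on the same coordinate and vanishes; only the tail
  -- part is left.
  act-Δ : ∀ {D} (f : V (suc D)) a y → act n (Δ n f) a y ≈ Δ n (act n f a) y
  act-Δ f a y = C.trans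
    (solve 6 (λ n₀ n₁ s₀ s₁ u₀ u₁ → n₀ :* (s₀ :+ u₀) :+ n₁ :* (s₁ :+ u₁) :=
      (n₀ :* s₀ :+ n₁ :* s₁) :+ (n₀ :* u₀ :+ n₁ :* u₁)) C.refl _ _ _ _ _ _)
    (C.trans (C.+-cong (C.sym (Δ-lincomb n _ _ _ _ y)) (C.trans (act-act n n f a y) vanish)) (C.+-identityʳ _))
    where
    vanish : act (n ⊙ n) f a y ≈ 0#
    vanish = C.trans
      (C.+-cong (C.*-congʳ (C.reflexive (cong gaussian (n²≡0 a false)))) (C.*-congʳ (C.reflexive (cong gaussian (n²≡0 a true)))))
      (C.trans (solve 2 (λ f₀ f₁ → con 0ᵍ :* f₀ :+ con 0ᵍ :* f₁ := con 0ᵍ) C.refl _ _) G.0-homo)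

  -- On V (suc D), Δ n is Δ n ⊗ 1 + 1 ⊗ n with commuting terms, and 1 ⊗ n squares to zero, so a
  -- power of it expands into two terms only.
  pow-vanishes : ∀ k {D} (f : V (suc D)) →
    (∀ a y → pow (Δ n) (suc k) (λ z → f (a ∷ z)) y ≈ 0#) → (∀ a y → pow (Δ n) k (act n f a) y ≈ 0#) →
    ∀ a y → pow (Δ n) (suc k) f (a ∷ y) ≈ 0#
  pow-vanishes zero    f p q a y = C.trans (C.+-cong (p a y) (q a y)) (C.+-identityˡ 0#)
  pow-vanishes (suc k) f p q = pow-vanishes k (Δ n f)
    (λ a y → C.trans (pow-Δ-+ n (suc k) (Δ n (λ z → f (a ∷ z))) (act n f a) y)
      (C.trans (C.+-cong (p a y) (q a y)) (C.+-identityˡ 0#)))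
    (λ a y → C.trans (pow-Δ-cong n k (act-Δ f a) y) (q a y))

  -- Among D + 1 factors spread over D coordinates, two share a coordinate. In the induction the
  -- slices of `f` need one power more than the hypothesis provides, so it is applied to their
  -- images under `Δ n`.
  Δ-nilpotent : ∀ {D} (f : V D) y → pow (Δ n) (suc D) f y ≈ 0#
  Δ-nilpotent {zero}  f []      = G.0-homo
  Δ-nilpotent {suc D} f (a ∷ y) = pow-vanishes (suc D) f
    (λ a → Δ-nilpotent (Δ n (λ z → f (a ∷ z)))) (λ a → Δ-nilpotent (act n f a)) a y

∑-0 : ∀ {D} {f : Vertex D → ℂ} → (∀ y → f y ≈ 0#) → ∑ f ≈ 0#
∑-0 {zero}  f≈0 = f≈0 []
∑-0 {suc D} f≈0 = C.trans (C.+-cong (∑-0 λ y → f≈0 (false ∷ y)) (∑-0 λ y → f≈0 (true ∷ y))) (C.+-identityˡ 0#)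

∑-swap : ∀ {D E} (f : Vertex D → Vertex E → ℂ) → ∑ (λ y → ∑ (f y)) ≈ ∑ (λ z → ∑ (λ y → f y z))
∑-swap {zero}  f = C.refl
∑-swap {suc D} f = C.trans
  (C.+-cong (∑-swap λ y → f (false ∷ y)) (∑-swap λ y → f (true ∷ y)))
  (C.sym (∑-+ (λ z → ∑ λ y → f (false ∷ y) z) (λ z → ∑ λ y → f (true ∷ y) z)))

∑-diagonal : ∀ {D} (y : Vertex D) c g →
  ∑ (λ z → (if does (Vec.≡-dec Bool._≟_ y z) then c else 0#) * g z) ≈ c * g y
∑-diagonal []          c g = C.refl
∑-diagonal (false ∷ y) c g = C.trans
  (C.+-cong (∑-diagonal y c λ z → g (false ∷ z)) (∑-0 {f = λ z → 0# * g (true ∷ z)} λ z → C.zeroˡ _)) (C.+-identityʳ _)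
∑-diagonal (true ∷ y)  c g = C.trans
  (C.+-cong (∑-0 {f = λ z → 0# * g (false ∷ z)} λ z → C.zeroˡ _) (∑-diagonal y c λ z → g (true ∷ z))) (C.+-identityˡ _)

does-≡-dec : ∀ {D} (y z : Vertex D) → (differences y z ℕ.≡ᵇ 0) ≡ does (Vec.≡-dec Bool._≟_ y z)
does-≡-dec []          []          = refl
does-≡-dec (false ∷ y) (false ∷ z) = does-≡-dec y z
does-≡-dec (false ∷ y) (true ∷ z)  = refl
does-≡-dec (true ∷ y)  (false ∷ z) = refl
does-≡-dec (true ∷ y)  (true ∷ z)  = does-≡-dec y z

-- Once the first coordinate is flipped, the adjacency test reduces to zero differences in the rest,
-- which is the form met in `A-Δ`.
∑-no-differences : ∀ {D} (y : Vertex D) g →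
  ∑ (λ z → (if differences y z ℕ.≡ᵇ 0 then 1# else 0#) * g z) ≈ g y
∑-no-differences y g = C.trans
  (∑-cong λ z → C.*-congʳ (C.reflexive (cong (if_then 1# else 0#) (does-≡-dec y z))))
  (C.trans (∑-diagonal y 1# g) (C.*-identityˡ (g y)))

-- With `false` as the first index these are σ_x, σ_z and -σ_y. Taking z before y reverses the
-- orientation, and the sign restores [σₖ₊₁, σₖ₊₂] = 2i σₖ.
σ : Fin 3 → Mat₂
σ zero             false true  = 1ᵍ
σ zero             true  false = 1ᵍ
σ (suc zero)       false false = 1ᵍ
σ (suc zero)       true  true  = 𝔾.- 1ᵍ
σ (suc (suc zero)) false true  = iᵍ
σ (suc (suc zero)) true  false = 𝔾.- iᵍ
σ _                _     _     = 0ᵍ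

-- A neighbour of `a ∷ y` either keeps `a` and moves in the tail, or flips `a` and keeps the tail;
-- these are the two halves of `∑`.
A-Δ : ∀ {D} (f : V D) y → (A ·ⱽ f) y ≈ Δ (σ zero) f y
A-Δ {zero}  f []          = C.trans (C.zeroˡ (f [])) (C.sym G.0-homo)
A-Δ {suc D} f (false ∷ y) = C.+-cong (A-Δ (λ z → f (false ∷ z)) y)
  (C.trans (∑-no-differences y λ z → f (true ∷ z))
    (solve 2 (λ f₀ f₁ → f₁ := con 0ᵍ :* f₀ :+ con 1ᵍ :* f₁) C.refl _ _))
A-Δ {suc D} f (true ∷ y)  = C.trans (C.+-comm _ _)
  (C.+-cong (A-Δ (λ z → f (true ∷ z)) y)
    (C.trans (∑-no-differences y λ z → f (false ∷ z))
      (solve 2 (λ f₀ f₁ → f₀ := con 1ᵍ :* f₀ :+ con 0ᵍ :* f₁) C.refl _ _)))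

-- Each coordinate contributes +1 if it is `false` and -1 if it is `true`, and these signs add up to
-- D - 2∂.
A*-Δ : ∀ {D} (f : V D) y → (A* ·ⱽ f) y ≈ Δ (σ (suc zero)) f y
A*-Δ f y = C.trans (∑-diagonal y _ f) (C.sym (eigenvalue f y))
  where
  eigenvalue : ∀ {D} (f : V D) y →
    Δ (σ (suc zero)) f y ≈ (fromℕ D - fromℕ (2 ℕ.* ∂ origin y)) * f y
  eigenvalue f [] = C.trans G.0-homo (C.sym (C.trans (C.*-congʳ (C.-‿inverseʳ 0#)) (C.zeroˡ (f []))))
  eigenvalue f (false ∷ y) = C.trans (C.+-congʳ (eigenvalue (λ z → f (false ∷ z)) y)) (C.trans
    (solve 4 (λ n k f₀ f₁ → (n :- k) :* f₀ :+ (con 1ᵍ :* f₀ :+ con 0ᵍ :* f₁) := ((con 1ᵍ :+ n) :- k) :* f₀)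
      C.refl _ _ _ _)
    (C.*-congʳ (C.+-congʳ (C.+-congʳ G.1-homo))))
  eigenvalue {suc D} f (true ∷ y) = C.trans (C.+-congʳ (eigenvalue (λ z → f (true ∷ z)) y)) (C.trans
    (solve 4 (λ n k f₀ f₁ → (n :- k) :* f₁ :+ (con 0ᵍ :* f₀ :+ con (𝔾.- 1ᵍ) :* f₁) :=
        ((con 1ᵍ :+ n) :- (con 1ᵍ :+ (con 1ᵍ :+ k))) :* f₁) C.refl _ _ _ _)
    (C.*-congʳ (C.trans
      (C.+-cong (C.+-congʳ G.1-homo) (C.-‿cong (C.+-cong G.1-homo (C.+-congʳ G.1-homo))))
      (C.+-congˡ (C.-‿cong (C.reflexive (cong fromℕ (≡.sym (ℕ.*-suc 2 (∂ origin y))))))))))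

-- Matrices acting on vectors, and T-modules

module _ {D : ℕ} where

  ·ⱽ-cong : (M : Mat D) {v w : V D} → (∀ y → v y ≈ w y) → ∀ y → (M ·ⱽ v) y ≈ (M ·ⱽ w) y
  ·ⱽ-cong M v≈w y = ∑-cong λ z → C.*-congˡ (v≈w z)

  +ᴹ-·ⱽ : ∀ (M N : Mat D) v y → ((M +ᴹ N) ·ⱽ v) y ≈ (M ·ⱽ v) y + (N ·ⱽ v) y
  +ᴹ-·ⱽ M N v y = C.trans (∑-cong λ z → C.distribʳ (v z) (M y z) (N y z)) (∑-+ {D} _ _)

  ·ᴹ-·ⱽ : ∀ c (M : Mat D) v y → ((c ·ᴹ M) ·ⱽ v) y ≈ c * (M ·ⱽ v) y
  ·ᴹ-·ⱽ c M v y = C.trans (∑-cong λ z → C.*-assoc c (M y z) (v z)) (∑-* {D} c _)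

  -ᴹ-·ⱽ : ∀ (M N : Mat D) v y → ((M -ᴹ N) ·ⱽ v) y ≈ (M ·ⱽ v) y - (N ·ⱽ v) y
  -ᴹ-·ⱽ M N v y = C.trans (∑-cong λ z → C.*-congʳ (C.+-congˡ (C.sym (CP.-1*x≈-x (N y z)))))
    (C.trans (+ᴹ-·ⱽ M (- 1# ·ᴹ N) v y) (C.+-congˡ (C.trans (·ᴹ-·ⱽ (- 1#) N v y) (CP.-1*x≈-x _))))

  *ᴹ-·ⱽ : ∀ (M N : Mat D) v y → ((M *ᴹ N) ·ⱽ v) y ≈ (M ·ⱽ (N ·ⱽ v)) y
  *ᴹ-·ⱽ M N v y = C.trans
    (∑-cong λ z → C.trans (C.*-comm _ (v z)) (C.trans (C.sym (∑-* (v z) (λ w → M y w * N w z)))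
      (∑-cong {D} {λ w → v z * (M y w * N w z)} {λ w → M y w * (N w z * v z)}
        λ w → solve 3 (λ a b c → c :* (a :* b) := a :* (b :* c)) C.refl (M y w) (N w z) (v z))))
    (C.trans (∑-swap (λ z w → M y w * (N w z * v z)))
      (∑-cong {D} λ w → ∑-* (M y w) (λ z → N w z * v z)))

  Iᴹ-·ⱽ : ∀ (v : V D) y → (Iᴹ ·ⱽ v) y ≈ v y
  Iᴹ-·ⱽ v y = C.trans (∑-diagonal y 1# v) (C.*-identityˡ (v y))

  module _ {W : Pred (V D) 0ℓ} (isSubspace : IsSubspace W) where

    A-A*-closed⇒isTModule : (∀ {v} → v ∈ W → A ·ⱽ v ∈ W) → (∀ {v} → v ∈ W → A* ·ⱽ v ∈ W) → IsTModule W
    A-A*-closed⇒isTModule A-closed A*-closed = record { isSubspace = isSubspace ; T-closed = closed }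
      where
      module W = IsSubspace isSubspace
      closed : ∀ {B v} → B ∈ T → v ∈ W → B ·ⱽ v ∈ W
      closed A∈T      v∈W = A-closed v∈W
      closed A*∈T     v∈W = A*-closed v∈W
      closed {v = v} I∈T v∈W = W.resp (λ y → C.sym (Iᴹ-·ⱽ v y)) v∈W
      closed {v = v} (T.+-closed {M} {N} M∈T N∈T) v∈W =
        W.resp (λ y → C.sym (+ᴹ-·ⱽ M N v y)) (W.+-closed (closed M∈T v∈W) (closed N∈T v∈W))
      closed {v = v} (T.*-closed {M} {N} M∈T N∈T) v∈W =
        W.resp (λ y → C.sym (*ᴹ-·ⱽ M N v y)) (closed M∈T (closed N∈T v∈W))
      closed {v = v} (T.·-closed c {M} M∈T) v∈W =
        W.resp (λ y → C.sym (·ᴹ-·ⱽ c M v y)) (W.*-closed c (closed M∈T v∈W))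
      closed {v = v} (T.resp M≈N M∈T) v∈W =
        W.resp (λ y → ∑-cong λ z → C.*-congʳ (M≈N y z)) (closed M∈T v∈W)

  excluded-middle : {W : Pred (V D) 0ℓ} → IsIrreducibleTModule W → ExcludedMiddle 0ℓ
  excluded-middle {W} irreducible {P} = decide (minimal U-isTModule proj₁)
    where
    open IsIrreducibleTModule irreducible
    open IsTModule isTModule
    module W = IsSubspace isSubspace
    w = proj₁ nonzero
    w∈W = proj₁ (proj₂ nonzero)
    w≉0 = proj₂ (proj₂ nonzero)

    U : Pred (V D) 0ℓ
    U v = v ∈ W × ((∀ y → v y ≈ 0#) ⊎ P)

    invariant : ∀ {B v} → B ∈ T → v ∈ U → B ·ⱽ v ∈ U
    invariant {B} B∈T (v∈W , zero-or-P) = T-closed B∈T v∈W ,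
      Sum.map₁ (λ v≈0 y → C.trans (·ⱽ-cong B v≈0 y) (·ⱽ-0 B y)) zero-or-P

    U-isTModule : IsTModule U
    U-isTModule = record
      { isSubspace = record
        { resp = λ v≈w (v∈W , z) → W.resp v≈w v∈W , Sum.map₁ (λ v≈0 y → C.trans (C.sym (v≈w y)) (v≈0 y)) z
        ; 0-closed = W.0-closed , inj₁ λ _ → C.refl
        ; +-closed = λ (v∈W , z) (w∈W , z′) → W.+-closed v∈W w∈W , both z z′
        ; *-closed = λ c (v∈W , z) → W.*-closed c v∈W , Sum.map₁ (λ v≈0 y → C.trans (C.*-congˡ (v≈0 y)) (C.zeroʳ c)) z
        }
      ; T-closed = invariant
      }
      where
      both : ∀ {v w : V D} → (∀ y → v y ≈ 0#) ⊎ P → (∀ y → w y ≈ 0#) ⊎ P → (∀ y → v y + w y ≈ 0#) ⊎ P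
      both (inj₂ p)   _          = inj₂ p
      both (inj₁ _)   (inj₂ p)   = inj₂ p
      both (inj₁ v≈0) (inj₁ w≈0) = inj₁ λ y → C.trans (C.+-cong (v≈0 y) (w≈0 y)) (C.+-identityˡ 0#)

    decide : (∀ {v} → v ∈ U → ∀ y → v y ≈ 0#) ⊎ W ⊆ U → Dec P
    -- The nonzero `w` belongs to `U` exactly when `P` holds.
    decide (inj₁ U≈0) = no λ p → w≉0 (U≈0 (w∈W , inj₂ p))
    decide (inj₂ W⊆U) with proj₂ (W⊆U w∈W)
    ... | inj₁ w≈0 = ⊥-elim (w≉0 w≈0)
    ... | inj₂ p   = yes p

-- Pauli matrix identities by evaluation

lincombᵐ : 𝔾 → Mat₂ → 𝔾 → Mat₂ → Mat₂
lincombᵐ p m q n a b = p 𝔾.* m a b 𝔾.+ q 𝔾.* n a b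

all-Bool? : {P : Bool → Set} → (∀ a → Dec (P a)) → Dec (∀ a → P a)
all-Bool? P? = map′ (λ (p , q) → λ { false → p ; true → q }) (λ p → p false , p true) (P? false ×-dec P? true)

infix 4 _≟ᵐ_
_≟ᵐ_ : (m n : Mat₂) → Dec (∀ a c → m a c ≡ n a c)
m ≟ᵐ n = all-Bool? λ a → all-Bool? λ c → m a c ≟ᵍ n a c

σ-raising σ-lowering : Fin 3 → Mat₂
σ-raising  k = lincombᵐ ½ᵍ (σ (next k)) ½iᵍ (σ (next (next k)))
σ-lowering k = lincombᵐ ½ᵍ (σ (next k)) (𝔾.- ½iᵍ) (σ (next (next k)))

σ-raising² : ∀ k a c → (σ-raising k ⊙ σ-raising k) a c ≡ 0ᵍ
σ-raising² = from-yes (Fin.all? λ k → (σ-raising k ⊙ σ-raising k) ≟ᵐ λ _ _ → 0ᵍ)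

σ-lowering² : ∀ k a c → (σ-lowering k ⊙ σ-lowering k) a c ≡ 0ᵍ
σ-lowering² = from-yes (Fin.all? λ k → (σ-lowering k ⊙ σ-lowering k) ≟ᵐ λ _ _ → 0ᵍ)

-- The summand with coefficient `0ᵍ` gives 2i σₖ the two-term shape that `Δ-matrix-lincomb` takes.
σ-commutator : ∀ k a c → (σ (next k) ⊙ σ (next (next k))) a c ≡
  (σ (next (next k)) ⊙ σ (next k)) a c 𝔾.+ lincombᵐ 2iᵍ (σ k) 0ᵍ (σ k) a c
σ-commutator = from-yes (Fin.all? λ k → (σ (next k) ⊙ σ (next (next k))) ≟ᵐ
  λ a c → (σ (next (next k)) ⊙ σ (next k)) a c 𝔾.+ lincombᵐ 2iᵍ (σ k) 0ᵍ (σ k) a c)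

Δ-σ-commutator : ∀ k {D} (f : V D) y →
  Δ (σ (next k)) (Δ (σ (next (next k))) f) y ≈
  Δ (σ (next (next k))) (Δ (σ (next k)) f) y + 2ic * Δ (σ k) f y
Δ-σ-commutator k f y = C.trans (Δ-commutator (σ-commutator k) f y) (C.+-congˡ
  (C.trans (Δ-matrix-lincomb {n = σ k} {σ k} (λ _ _ → refl) f y)
    (solve 1 (λ s → con 2iᵍ :* s :+ con 0ᵍ :* s := con 2iᵍ :* s) C.refl _)))

-- The commutator of the first two operators is 2i times the third, and (-i/2)(2i) = 1.
Aᵋ-Δ : ∀ {D} (f : V D) y → (Aᵋ ·ⱽ f) y ≈ Δ (σ (suc (suc zero))) f y
Aᵋ-Δ f y = C.trans (·ᴹ-·ⱽ (- 𝐢 * rational ½) (A *ᴹ A* -ᴹ A* *ᴹ A) f y) (C.trans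
  (C.*-cong scalar (C.trans (-ᴹ-·ⱽ (A *ᴹ A*) (A* *ᴹ A) f y) (C.+-cong AA* (C.-‿cong A*A))))
  (using-equation (gaussian (𝔾.- ½iᵍ)) (Δ-σ-commutator (suc (suc zero)) f y)
    (solve 3 (λ xz zx e →
      con (𝔾.- ½iᵍ) :* (xz :- zx) :+ con (𝔾.- ½iᵍ) :* (zx :+ con 2iᵍ :* e) := e :+ con (𝔾.- ½iᵍ) :* xz)
      C.refl _ _ _)))
  where
  X = σ zero
  Z = σ (suc zero)
  scalar : - 𝐢 * rational ½ ≈ gaussian (𝔾.- ½iᵍ)
  scalar = termwise (λ _ → refl) , termwise (λ _ → refl)
  AA* : ((A *ᴹ A*) ·ⱽ f) y ≈ Δ X (Δ Z f) y
  AA* = C.trans (*ᴹ-·ⱽ A A* f y) (C.trans (A-Δ (A* ·ⱽ f) y) (Δ-cong X (A*-Δ f) y))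
  A*A : ((A* *ᴹ A) ·ⱽ f) y ≈ Δ Z (Δ X f) y
  A*A = C.trans (*ᴹ-·ⱽ A* A f y) (C.trans (A*-Δ (A ·ⱽ f) y) (Δ-cong Z (A-Δ f) y))

-- The three restrictions to an irreducible T-module

module _ {D : ℕ} {W : Pred (V D) 0ℓ} (irreducible : IsIrreducibleTModule W) where
  open IsIrreducibleTModule irreducible
  open IsTModule isTModule

  private
    em : ExcludedMiddle 0ℓ
    em = excluded-middle irreducible

    op : Fin 3 → LinearOperator (vectorSpace isTModule)
    op = restrict isTModule A A∈T Vector.∷ restrict isTModule A* A*∈T Vector.∷
      restrict isTModule Aᵋ Aᵋ∈T Vector.∷ Vector.[]

  open Representation em W isSubspace
  open LeonardTriples em W isSubspace

  private
    L : Fin 3 → Carrierᴹ → Carrierᴹ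
    L k = LinearOperator.apply (op k)

  op-Δ : ∀ k u y → proj₁ (L k u) y ≈ Δ (σ k) (proj₁ u) y
  op-Δ zero             u = A-Δ (proj₁ u)
  op-Δ (suc zero)       u = A*-Δ (proj₁ u)
  op-Δ (suc (suc zero)) u = Aᵋ-Δ (proj₁ u)

  op-op-Δ : ∀ k l u y → proj₁ (L k (L l u)) y ≈ Δ (σ k) (Δ (σ l) (proj₁ u)) y
  op-op-Δ k l u y = C.trans (op-Δ k (L l u) y) (Δ-cong (σ k) (op-Δ l u) y)

  op-commutator : IsCyclic op
  op-commutator k u = pointwise λ y → C.trans (op-op-Δ (next k) (next (next k)) u y)
    (C.trans (Δ-σ-commutator k (proj₁ u) y)
    (C.sym (C.+-cong (op-op-Δ (next (next k)) (next k) u y)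
      (C.*-congˡ (op-Δ k u y)))))

  open Operators op op-commutator hiding (L)

  raise-Δ : ∀ k u y → proj₁ (Cyclic.raise k u) y ≈ Δ (σ-raising k) (proj₁ u) y
  raise-Δ k u y = C.trans
    (C.+-cong (C.*-congˡ (op-Δ (next k) u y)) (C.*-congˡ (op-Δ (next (next k)) u y)))
    (C.sym (Δ-matrix-lincomb {n = σ (next k)} {σ (next (next k))} (λ _ _ → refl) (proj₁ u) y))

  lower-Δ : ∀ k u y → proj₁ (Cyclic.lower k u) y ≈ Δ (σ-lowering k) (proj₁ u) y
  lower-Δ k u y = C.trans
    (C.+-cong (C.*-congˡ (op-Δ (next k) u y))
      (C.*-cong (C.sym (G.-‿homo ½iᵍ)) (op-Δ (next (next k)) u y)))
    (C.sym (Δ-matrix-lincomb {n = σ (next k)} {σ (next (next k))} (λ _ _ → refl) (proj₁ u) y))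

  pow-Δ : (f : Carrierᴹ → Carrierᴹ) (m : Mat₂) → (∀ u y → proj₁ (f u) y ≈ Δ m (proj₁ u) y) →
    ∀ n u y → proj₁ (pow f n u) y ≈ pow (Δ m) n (proj₁ u) y
  pow-Δ f m f≈m zero    u y = C.refl
  pow-Δ f m f≈m (suc n) u y = C.trans (pow-Δ f m f≈m n (f u) y)
    (pow-Δ-cong m n (f≈m u) y)

  submodule-whole : ∀ {P} → IsSubmodule P → ∀ {u} → P u → ¬ u ≋ 0ᵁ → ∀ w → P w
  submodule-whole {P} submodule {u} Pu u≉0 (w , w∈W) = [ only-zero , whole ]′ (minimal P̂-isTModule proj₁)
    where
    module W = IsSubspace isSubspace
    open IsSubmodule submodule

    P̂ : Pred (V D) 0ℓ
    P̂ v = Σ (v ∈ W) λ v∈W → P (v , v∈W)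

    P̂-isTModule : IsTModule P̂
    P̂-isTModule = A-A*-closed⇒isTModule (record
      { resp = λ v≈w (v∈W , Pv) → W.resp v≈w v∈W , P-resp (pointwise v≈w) Pv
      -- Zero is obtained as 0u + 0u from the given member `u`.
      ; 0-closed = W.0-closed , P-resp (⊕-zero (*ₗ-zeroˡ u) (*ₗ-zeroˡ u)) (P-lincomb 0# 0# Pu Pu)
      ; +-closed = λ (v∈W , Pv) (w∈W , Pw) → W.+-closed v∈W w∈W , P-resp (⊕-as-lincomb _ _) (P-lincomb 1c 1c Pv Pw)
      ; *-closed = λ c (v∈W , Pv) → W.*-closed c v∈W , P-resp (*ₗ-as-lincomb c _) (P-lincomb c 0# Pv Pv)
      }) (λ (v∈W , Pv) → _ , P-op zero Pv) (λ (v∈W , Pv) → _ , P-op (suc zero) Pv)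

    only-zero : (∀ {v} → v ∈ P̂ → ∀ y → v y ≈ 0#) → P (w , w∈W)
    only-zero P̂≈0 = ⊥-elim (u≉0 (pointwise (P̂≈0 (proj₂ u , Pu))))

    whole : W ⊆ P̂ → P (w , w∈W)
    -- The membership proof inside `P̂` may differ from `w∈W`; `≋` compares only the underlying
    -- vectors.
    whole W⊆P̂ = P-resp (pointwise λ _ → C.refl) (proj₂ (W⊆P̂ w∈W))

  isLeonardTriple : IsLeonardTriple (vectorSpace isTModule)
    (restrict isTModule A A∈T) (restrict isTModule A* A*∈T) (restrict isTModule Aᵋ Aᵋ∈T)
  isLeonardTriple = isLeonard
    where
    open Irreducible submodule-whole {proj₁ nonzero , proj₁ (proj₂ nonzero)} (λ w≈0 → proj₂ (proj₂ nonzero) (at w≈0))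
      {suc D}
      (λ k u → pointwise λ y → C.trans (pow-Δ (Cyclic.raise k) (σ-raising k) (raise-Δ k) (suc D) u y)
        (Δ-nilpotent {σ-raising k} (σ-raising² k) (proj₁ u) y))
      (λ k u → pointwise λ y → C.trans (pow-Δ (Cyclic.lower k) (σ-lowering k) (lower-Δ k) (suc D) u y)
        (Δ-nilpotent {σ-lowering k} (σ-lowering² k) (proj₁ u) y))

corollary10p5 : (D : ℕ) .{{_ : NonZero D}} (W : Pred (V D) 0ℓ) (irreducible : IsIrreducibleTModule W) →
    let isTModule = IsIrreducibleTModule.isTModule irreducible in
    IsLeonardTriple (vectorSpace isTModule) (restrict isTModule A A∈T) (restrict isTModule A* A*∈T) (restrict isTModule Aᵋ Aᵋ∈T)
corollary10p5 D W irreducible = isLeonardTriple irreducible
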